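{- Let $q$ be a prime power and let $C$ be the set of points contained in a hyperbolic line of $\mathsf{W}_3(q)$. Then $C$ is a neighbour-transitive maximal partial ovoid.
   Context: $\mathsf{W}_3(q)$: let $V=\mathbb{F}_q^4$ be equipped with a non-degenerate symplectic bilinear form $f$. Points are the $1$-dimensional subspaces of $V$, lines are the totally isotropic $2$-dimensional subspaces of $V$, incidence is symmetrised containment. Its point-line incidence graph $\varGamma$ has all points and lines as vertices, with adjacency given by incidence. A hyperbolic line is a $2$-dimensional subspace $W$ of $V$ on which $f$ is non-degenerate; its points are the $q+1$ one-dimensional subspaces of $W$. A partial ovoid is a set of points such that each line is incident with at most one point of the set; it is maximal if it is not properly contained in another partial ovoid. A code $C$ is a subset of the vertex set of $\varGamma$; $C_1$ is the set of vertices not in $C$ that are adjacent to some element of $C$; $\operatorname{Aut}(C)$ is the setwise stabiliser of $C$ in $\operatorname{Aut}(\varGamma)$; $C$ is neighbour-transitive if $\operatorname{Aut}(C)$ acts transitively on each of $C$ and $C_1$. -}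

module Defs where

open import Algebra.Apartness.Bundles using (HeytingField; HeytingCommutativeRing)
open import Algebra.Bundles using (CommutativeRing)
import Algebra.Properties.Monoid.Sum as MonoidSum
open import Data.Empty.Polymorphic using (⊥)
open import Data.Fin.Base using (Fin)
open import Data.Nat.Base using (ℕ; _^_; _≤_)
open import Data.Nat.Primality using (Prime)
open import Data.Product.Base using (_×_; ∃₂; ∃-syntax; proj₂)
open import Data.Sum.Base using (inj₁; inj₂)
open import Data.Sum.Relation.Binary.Pointwise using (_⊎ₛ_; inj₁; inj₂)
open import Data.Vec.Functional using (Vector; map; replicate; zipWith)
import Data.Vec.Functional.Relation.Binary.Equality.Setoid as VectorEquality
open import Function.Base using (_∘_)
open import Function.Bundles using (Inverse; _⇔_)
open import Level using (Level; _⊔_; suc)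
open import Relation.Binary.Bundles using (Setoid)
import Relation.Binary.Construct.On as On
open import Relation.Binary.Core using (Rel)
open import Relation.Binary.Definitions using (_Respects_)
open import Relation.Binary.PropositionalEquality using (_≡_)
import Relation.Binary.PropositionalEquality.Properties as ≡
open import Relation.Unary using (Pred; _∈_; _∉_; _⊆_; _⊄_; U)
open import Relation.Unary.Relation.Binary.Equality using (≐-setoid)

IsPrimePower : ℕ → Set
IsPrimePower q = ∃₂ λ p k → Prime p × 1 ≤ k × q ≡ p ^ k

-- With finitely many elements, equality and invertibility are decidable, so a
-- Heyting field having q elements is a field of order q in the usual sense.
HasOrder : ∀ {c ℓ₁ ℓ₂} → HeytingField c ℓ₁ ℓ₂ → ℕ → Set (c ⊔ ℓ₁)
HasOrder F q = Inverse (CommutativeRing.setoid ring) (≡.setoid (Fin q))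
  where ring = HeytingCommutativeRing.commutativeRing (HeytingField.heytingCommutativeRing F)

-- Subsets of a setoid: predicates that cannot separate equal elements.
record Subset {a ℓ} (S : Setoid a ℓ) (p : Level) : Set (a ⊔ ℓ ⊔ suc p) where
  open Setoid S
  field
    member   : Pred Carrier p
    respects : member Respects _≈_

open Subset public

module LinearAlgebra {c ℓ₁ ℓ₂} (F : HeytingField c ℓ₁ ℓ₂) where

  open CommutativeRing
    (HeytingCommutativeRing.commutativeRing (HeytingField.heytingCommutativeRing F))
    renaming (Carrier to K)
    using (_≈_; _+_; _*_; 0#; setoid; +-monoid) public

  open MonoidSum +-monoid using (sum)
  open VectorEquality setoid using (≋-setoid)

  V : Set c
  V = Vector K 4

  Vₛ : Setoid c ℓ₁
  Vₛ = ≋-setoid 4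

  open Setoid Vₛ public using () renaming (_≈_ to _≈ᵛ_)

  0ᵛ : V
  0ᵛ = replicate 4 0#

  infixl 6 _+ᵛ_
  infixr 7 _*ᵛ_

  _+ᵛ_ : V → V → V
  _+ᵛ_ = zipWith _+_

  _*ᵛ_ : K → V → V
  a *ᵛ v = map (a *_) v

  linearCombination : ∀ {d} → Vector K d → Vector V d → V
  linearCombination a b j = sum (λ i → a i * b i j)

  record Subspace : Set (suc (c ⊔ ℓ₁)) where
    field
      vectors  : Subset Vₛ (c ⊔ ℓ₁)
      0-closed : 0ᵛ ∈ member vectors
      +-closed : ∀ {u v} → u ∈ member vectors → v ∈ member vectors → (u +ᵛ v) ∈ member vectors
      *-closed : ∀ a {v} → v ∈ member vectors → (a *ᵛ v) ∈ member vectors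

    ⟦_⟧ : Pred V (c ⊔ ℓ₁)
    ⟦_⟧ = member vectors

  open Subspace public using (⟦_⟧)

  record Basis (W : Subspace) (d : ℕ) : Set (c ⊔ ℓ₁) where
    field
      basis       : Vector V d
      inside      : ∀ i → basis i ∈ ⟦ W ⟧
      independent : ∀ a → linearCombination a basis ≈ᵛ 0ᵛ → ∀ i → a i ≈ 0#
      spanning    : ∀ {v} → v ∈ ⟦ W ⟧ → ∃[ a ] v ≈ᵛ linearCombination a basis

  HasDimension : Subspace → ℕ → Set (c ⊔ ℓ₁)
  HasDimension = Basis

  TotallyIsotropicOn : ∀ {p} → (V → V → K) → Pred V p → Set (c ⊔ ℓ₁ ⊔ p)
  TotallyIsotropicOn f P = ∀ {u v} → u ∈ P → v ∈ P → f u v ≈ 0#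

  -- Only the left radical is mentioned; for the alternating forms below it
  -- coincides with the right radical.
  NonDegenerateOn : ∀ {p} → (V → V → K) → Pred V p → Set (c ⊔ ℓ₁ ⊔ p)
  NonDegenerateOn f P = ∀ {u} → u ∈ P → (∀ {v} → v ∈ P → f u v ≈ 0#) → u ≈ᵛ 0ᵛ

  record IsBilinear (f : V → V → K) : Set (c ⊔ ℓ₁) where
    field
      cong : ∀ {u u′ v v′} → u ≈ᵛ u′ → v ≈ᵛ v′ → f u v ≈ f u′ v′
      +ˡ   : ∀ u u′ v → f (u +ᵛ u′) v ≈ f u v + f u′ v
      +ʳ   : ∀ u v v′ → f u (v +ᵛ v′) ≈ f u v + f u v′
      *ˡ   : ∀ a u v → f (a *ᵛ u) v ≈ a * f u v
      *ʳ   : ∀ a u v → f u (a *ᵛ v) ≈ a * f u v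

  -- Symplectic means f v v = 0, which in characteristic 2 is stronger than
  -- skew-symmetry.
  record NonDegenerateSymplecticForm : Set (c ⊔ ℓ₁) where
    field
      form          : V → V → K
      bilinear      : IsBilinear form
      alternating   : ∀ v → form v v ≈ 0#
      nonDegenerate : NonDegenerateOn form U

module W₃ {c ℓ₁ ℓ₂} (F : HeytingField c ℓ₁ ℓ₂)
          (f : LinearAlgebra.NonDegenerateSymplecticForm F) where

  open LinearAlgebra F
  open NonDegenerateSymplecticForm f using (form)

  record Point : Set (suc (c ⊔ ℓ₁)) where
    field
      subspace  : Subspace
      dimension : HasDimension subspace 1

  record Line : Set (suc (c ⊔ ℓ₁)) where
    field
      subspace  : Subspace
      dimension : HasDimension subspace 2
      isotropic : TotallyIsotropicOn form ⟦ subspace ⟧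

  record HyperbolicLine : Set (suc (c ⊔ ℓ₁)) where
    field
      subspace      : Subspace
      dimension     : HasDimension subspace 2
      nonDegenerate : NonDegenerateOn form ⟦ subspace ⟧

  -- Points, and likewise lines, are equal when they contain the same vectors;
  -- the chosen bases are irrelevant.
  Pointₛ : Setoid (suc (c ⊔ ℓ₁)) (c ⊔ ℓ₁)
  Pointₛ = On.setoid (≐-setoid V (c ⊔ ℓ₁)) (⟦_⟧ ∘ Point.subspace)

  Lineₛ : Setoid (suc (c ⊔ ℓ₁)) (c ⊔ ℓ₁)
  Lineₛ = On.setoid (≐-setoid V (c ⊔ ℓ₁)) (⟦_⟧ ∘ Line.subspace)

  Incident : Point → Line → Set (c ⊔ ℓ₁)
  Incident P L = ⟦ Point.subspace P ⟧ ⊆ ⟦ Line.subspace L ⟧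

  Vertexₛ : Setoid _ _
  Vertexₛ = Pointₛ ⊎ₛ Lineₛ

  Vertex : Set (suc (c ⊔ ℓ₁))
  Vertex = Setoid.Carrier Vertexₛ

  infix 4 _∼_ _≈ᴾ_ _≈ⱽ_

  _≈ᴾ_ = Setoid._≈_ Pointₛ
  _≈ⱽ_ = Setoid._≈_ Vertexₛ

  _∼_ : Rel Vertex (c ⊔ ℓ₁)
  inj₁ P ∼ inj₂ L = Incident P L
  inj₂ L ∼ inj₁ P = Incident P L
  inj₁ _ ∼ inj₁ _ = ⊥
  inj₂ _ ∼ inj₂ _ = ⊥

  PointSet : Set _
  PointSet = Subset Pointₛ (c ⊔ ℓ₁)

  pointsOf : HyperbolicLine → PointSet
  pointsOf W = record
    { member   = λ P → ⟦ Point.subspace P ⟧ ⊆ ⟦ HyperbolicLine.subspace W ⟧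
    ; respects = λ P≈Q P⊆W v∈Q → P⊆W (proj₂ P≈Q v∈Q)
    }

  IsPartialOvoid : PointSet → Set _
  IsPartialOvoid S = ∀ (L : Line) {P Q} → P ∈ member S → Q ∈ member S →
                     Incident P L → Incident Q L → P ≈ᴾ Q

  IsMaximalPartialOvoid : PointSet → Set _
  IsMaximalPartialOvoid S =
    IsPartialOvoid S × (∀ S′ → IsPartialOvoid S′ → member S ⊄ member S′)

  Code : (p : Level) → Set _
  Code p = Subset Vertexₛ p

  pointCode : PointSet → Code (c ⊔ ℓ₁)
  pointCode S = record { member = mem ; respects = resp }
    where
    mem : Pred Vertex (c ⊔ ℓ₁)
    mem (inj₁ P) = P ∈ member S
    mem (inj₂ _) = ⊥

    resp : mem Respects _≈ⱽ_
    resp (inj₁ P≈Q) P∈S = respects S P≈Q P∈S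

  Neighbours : ∀ {p} → Code p → Pred Vertex _
  Neighbours C x = x ∉ member C × (∃[ y ] y ∈ member C × x ∼ y)

  record Automorphism : Set (suc (c ⊔ ℓ₁)) where
    field
      permutation : Inverse Vertexₛ Vertexₛ

    open Inverse permutation public using (to)

    field
      adjacency : ∀ x y → x ∼ y ⇔ to x ∼ to y

  open Automorphism using (to)

  Stabilises : ∀ {p} → Automorphism → Code p → Set _
  Stabilises g C = ∀ x → x ∈ member C ⇔ to g x ∈ member C

  StabiliserTransitiveOn : ∀ {p r} → Code p → Pred Vertex r → Set _
  StabiliserTransitiveOn C X =
    ∀ {x y} → x ∈ X → y ∈ X → ∃[ g ] Stabilises g C × to g x ≈ⱽ y

  IsNeighbourTransitive : ∀ {p} → Code p → Set _
  IsNeighbourTransitive C =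
    StabiliserTransitiveOn C (member C) × StabiliserTransitiveOn C (Neighbours C)

{-# OPTIONS --safe #-}

-- V is the orthogonal sum of W and its perp, and both are hyperbolic planes, in
-- which orthogonal vectors are proportional; for the perp this uses that V has
-- dimension 4. Hence distinct points of W are not collinear. If p is a vector
-- outside W, then some nonzero w in W is orthogonal to p (its projection to W,
-- or any w if that vanishes), so the point ⟨p⟩ is collinear with the point ⟨w⟩.
-- For non-orthogonal p and q in a plane, the transvection with centre q - p
-- takes p to q and fixes the other plane pointwise. A line meeting W in ⟨p⟩ is
-- ⟨p, u⟩ with u in the perp, so two such transvections move it to any other.
module Submission where

open import Defs
open import Algebra.Apartness.Bundles using (HeytingField; HeytingCommutativeRing)
open import Algebra.Bundles using (CommutativeRing)
import Algebra.Properties.AbelianGroup as AbelianGroupProperties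
import Algebra.Properties.Ring as RingProperties
import Algebra.Properties.Semiring.Mult.TCOptimised as Multiplication
import Algebra.Properties.Semiring.Sum as SemiringSum
import Algebra.Solver.Ring as RingSolver
open import Algebra.Solver.Ring.AlmostCommutativeRing using (fromCommutativeRing; _-Raw-AlmostCommutative⟶_)
open import Data.Fin.Base using (Fin; zero; suc; punchIn)
open import Data.Fin.Patterns using (0F; 1F; 2F; 3F; 4F)
import Data.Fin.Properties as Fin
open import Data.Integer.Base as ℤ using (ℤ; +_; -[1+_]; _⊖_; 0ℤ)
import Data.Integer.Properties as ℤ
open import Data.Maybe.Base using (map)
open import Data.Nat.Base as ℕ using (ℕ; zero; suc)
open import Data.Product.Base using (_×_; _,_; proj₁; proj₂; ∃; ∃₂; ∃-syntax)
open import Data.Sum.Base using (inj₁; inj₂)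
open import Data.Sum.Relation.Binary.Pointwise using (inj₁; inj₂)
open import Data.Vec.Functional using (Vector; []; _∷_; tail)
open import Function.Base using (_∘_; id)
open import Function.Bundles using (Inverse; _⇔_; mk⇔)
open import Level using (_⊔_)
open import Relation.Binary.Bundles using (Setoid)
open import Relation.Binary.Definitions using (Decidable)
open import Relation.Binary.PropositionalEquality as ≡ using (_≡_)
import Relation.Binary.Reasoning.Setoid as ≈-Reasoning
open import Relation.Nullary.Decidable using (Dec; yes; no; dec⇒maybe; map′)
open import Relation.Nullary.Negation using (¬_; contradiction)
open import Relation.Unary using (_∈_; _⊆_; _⊂_)

-- Membership in a subspace is an arbitrary predicate and need not be decidable, whereas equality of
-- vectors is, because the field is finite. Case distinctions are therefore made on vectors and
-- scalars: `v` lies in W exactly when its component `π⊥ v` in the perp vanishes, and this can be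
-- decided. Nor is a basis of the perp ever constructed. All that moving vectors within either plane
-- requires is that orthogonal vectors are proportional. For W this is a determinant computation;
-- for the perp it comes from a linear relation among five vectors. The same property closes the
-- case that transvections leave open, since nonzero orthogonal vectors of a plane already span the
-- same point. Vectors need to be moved only up to a scalar, and each map comes with an explicit
-- inverse, so that equality of subspaces is a pair of inclusions and needs no dimension count.

-- A ring solver with integer coefficients: unlike coefficients taken from the
-- ring itself, these compute, so that additive cancellations are recognised.
module IntegerSolver {c ℓ} (R : CommutativeRing c ℓ) where

  open CommutativeRing R
  open RingProperties ring using (-‿distribˡ-*; -0#≈0#; -‿involutive)
  open AbelianGroupProperties +-abelianGroup using (⁻¹-∙-comm)
  open Multiplication semiring using (×-homo-+; ×1-homo-*) renaming (_×_ to _·_)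
  open ≈-Reasoning setoid

  ⟦_⟧ℤ : ℤ → Carrier
  ⟦ + n ⟧ℤ      = n · 1#
  ⟦ -[1+ n ] ⟧ℤ = - (suc n · 1#)

  ⟦⟧-neg : ∀ i → ⟦ ℤ.- i ⟧ℤ ≈ - ⟦ i ⟧ℤ
  ⟦⟧-neg (+ zero)  = sym -0#≈0#
  ⟦⟧-neg (+ suc n) = refl
  ⟦⟧-neg -[1+ n ]  = sym (-‿involutive _)

  1+-homo : ∀ n → suc n · 1# ≈ 1# + n · 1#
  1+-homo n = ×-homo-+ 1# 1 n

  ⟦⟧-⊖ : ∀ m n → ⟦ m ⊖ n ⟧ℤ ≈ m · 1# - n · 1#
  ⟦⟧-⊖ m       zero    = sym (trans (+-congˡ -0#≈0#) (+-identityʳ _))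
  ⟦⟧-⊖ zero    (suc n) = sym (+-identityˡ _)
  ⟦⟧-⊖ (suc m) (suc n) = begin
    ⟦ suc m ⊖ suc n ⟧ℤ                 ≡⟨ ≡.cong ⟦_⟧ℤ (ℤ.[1+m]⊖[1+n]≡m⊖n m n) ⟩
    ⟦ m ⊖ n ⟧ℤ                         ≈⟨ ⟦⟧-⊖ m n ⟩
    m · 1# - n · 1#                    ≈⟨ +-congʳ (sym (+-identityʳ _)) ⟩
    m · 1# + 0# - n · 1#               ≈⟨ +-congʳ (+-congˡ (sym (-‿inverseʳ 1#))) ⟩
    m · 1# + (1# - 1#) - n · 1#        ≈⟨ +-congʳ (sym (+-assoc _ _ _)) ⟩
    m · 1# + 1# - 1# - n · 1#          ≈⟨ +-assoc _ _ _ ⟩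
    m · 1# + 1# + (- 1# - n · 1#)      ≈⟨ +-cong (+-comm _ _) (⁻¹-∙-comm _ _) ⟩
    (1# + m · 1#) - (1# + n · 1#)      ≈⟨ +-cong (sym (1+-homo m)) (-‿cong (sym (1+-homo n))) ⟩
    suc m · 1# - suc n · 1#            ∎

  ⟦⟧-+ : ∀ i j → ⟦ i ℤ.+ j ⟧ℤ ≈ ⟦ i ⟧ℤ + ⟦ j ⟧ℤ
  ⟦⟧-+ (+ m)    (+ n)    = ×-homo-+ 1# m n
  ⟦⟧-+ (+ m)    -[1+ n ] = ⟦⟧-⊖ m (suc n)
  ⟦⟧-+ -[1+ m ] (+ n)    = trans (⟦⟧-⊖ n (suc m)) (+-comm _ _)
  ⟦⟧-+ -[1+ m ] -[1+ n ] = begin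
    - (suc (suc (m ℕ.+ n)) · 1#)        ≡⟨ ≡.cong (λ k → - (suc k · 1#)) (≡.sym (ℕ.+-suc m n)) ⟩
    - ((suc m ℕ.+ suc n) · 1#)          ≈⟨ -‿cong (×-homo-+ 1# (suc m) (suc n)) ⟩
    - (suc m · 1# + suc n · 1#)         ≈⟨ sym (⁻¹-∙-comm _ _) ⟩
    - (suc m · 1#) - suc n · 1#         ∎
    where import Data.Nat.Properties as ℕ

  ⟦⟧-*⁺ : ∀ m j → ⟦ + m ℤ.* j ⟧ℤ ≈ ⟦ + m ⟧ℤ * ⟦ j ⟧ℤ
  ⟦⟧-*⁺ m (+ n)    = trans (reflexive (≡.cong ⟦_⟧ℤ (≡.sym (ℤ.pos-* m n)))) (×1-homo-* m n)
  ⟦⟧-*⁺ m -[1+ n ] = begin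
    ⟦ + m ℤ.* -[1+ n ] ⟧ℤ            ≡⟨ ≡.cong ⟦_⟧ℤ (≡.sym (ℤ.neg-distribʳ-* (+ m) (+ suc n))) ⟩
    ⟦ ℤ.- (+ m ℤ.* + suc n) ⟧ℤ       ≈⟨ ⟦⟧-neg (+ m ℤ.* + suc n) ⟩
    - ⟦ + m ℤ.* + suc n ⟧ℤ           ≈⟨ -‿cong (⟦⟧-*⁺ m (+ suc n)) ⟩
    - (⟦ + m ⟧ℤ * ⟦ + suc n ⟧ℤ)      ≈⟨ -‿distribʳ-* _ _ ⟩
    ⟦ + m ⟧ℤ * - ⟦ + suc n ⟧ℤ        ∎
    where open RingProperties ring using (-‿distribʳ-*)

  ⟦⟧-* : ∀ i j → ⟦ i ℤ.* j ⟧ℤ ≈ ⟦ i ⟧ℤ * ⟦ j ⟧ℤ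
  ⟦⟧-* (+ m)    j = ⟦⟧-*⁺ m j
  ⟦⟧-* -[1+ m ] j = begin
    ⟦ -[1+ m ] ℤ.* j ⟧ℤ           ≡⟨ ≡.cong ⟦_⟧ℤ (≡.sym (ℤ.neg-distribˡ-* (+ suc m) j)) ⟩
    ⟦ ℤ.- (+ suc m ℤ.* j) ⟧ℤ      ≈⟨ ⟦⟧-neg (+ suc m ℤ.* j) ⟩
    - ⟦ + suc m ℤ.* j ⟧ℤ          ≈⟨ -‿cong (⟦⟧-*⁺ (suc m) j) ⟩
    - (⟦ + suc m ⟧ℤ * ⟦ j ⟧ℤ)     ≈⟨ -‿distribˡ-* _ _ ⟩
    - ⟦ + suc m ⟧ℤ * ⟦ j ⟧ℤ       ∎

  homomorphism : CommutativeRing.rawRing ℤ.+-*-commutativeRing -Raw-AlmostCommutative⟶ fromCommutativeRing R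
  homomorphism = record
    { ⟦_⟧    = ⟦_⟧ℤ
    ; +-homo = ⟦⟧-+
    ; *-homo = ⟦⟧-*
    ; -‿homo = ⟦⟧-neg
    ; 0-homo = refl
    ; 1-homo = refl
    }

  open RingSolver (CommutativeRing.rawRing ℤ.+-*-commutativeRing) (fromCommutativeRing R) homomorphism
    (λ i j → map (λ i≡j → reflexive (≡.cong ⟦_⟧ℤ i≡j)) (dec⇒maybe (i ℤ.≟ j))) public

-- Finite fields: inverses and linear dependence

module FiniteField {c ℓ₁ ℓ₂} {q : ℕ} (F : HeytingField c ℓ₁ ℓ₂) (order : HasOrder F q) where

  open HeytingField F using (heytingCommutativeRing; _#_; tight; #⇒invertible; invertible⇒#)

  R : CommutativeRing c ℓ₁
  R = HeytingCommutativeRing.commutativeRing heytingCommutativeRing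

  open CommutativeRing R renaming (Carrier to K) hiding (zero)
  open SemiringSum semiring using (sum; sum-cong-≋; sum-replicate-zero)
  open IntegerSolver R using (solve; con; :-_; _:+_; _:*_; _:-_; _:=_)

  private module Order = Inverse order

  infix 4 _≟_

  opaque
    _≟_ : Decidable _≈_
    x ≟ y = map′ from-injective Order.to-cong (Order.to x Fin.≟ Order.to y)
      where
      from-injective : Order.to x ≡ Order.to y → x ≈ y
      from-injective eq = trans (sym (Order.strictlyInverseʳ x)) (trans (Order.from-cong eq) (Order.strictlyInverseʳ y))

  x-0≈x : ∀ x → x - 0# ≈ x
  x-0≈x = solve 1 (λ x → x :- con 0ℤ := x) refl

  -- The axioms only give ¬ ¬ (x # 0#) for x ≉ 0#; an actual inverse is found by
  -- searching through the finitely many elements.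
  opaque
    inverse : ∀ {x} → x ≉ 0# → ∃[ y ] y * x ≈ 1#
    inverse {x} x≉0 with Fin.any? (λ i → Order.from i * x ≟ 1#)
    ... | yes (i , inv) = Order.from i , inv
    ... | no  ¬inv      = contradiction (proj₁ (tight x 0#) ¬x#0) x≉0
      where
      ¬x#0 : ¬ (x # 0#)
      ¬x#0 x#0 with y , y[x-0]≈1 , _ ← #⇒invertible x#0 =
        ¬inv (Order.to y , trans (*-cong (Order.strictlyInverseʳ y) (sym (x-0≈x x))) y[x-0]≈1)

  1≉0 : 1# ≉ 0#
  1≉0 1≈0 = proj₂ (tight 1# 0#) 1≈0 (invertible⇒# {1#} {0#} (1# , inv , trans (*-comm _ _) inv))
    where
    inv : 1# * (1# - 0#) ≈ 1#
    inv = solve 0 (con (+ 1) :* (con (+ 1) :- con 0ℤ) := con (+ 1)) refl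

  x*y≈0⇒x≈0 : ∀ {x y} → y ≉ 0# → x * y ≈ 0# → x ≈ 0#
  x*y≈0⇒x≈0 {x} {y} y≉0 xy≈0 with z , zy≈1 ← inverse y≉0 = begin
    x             ≈⟨ *-identityʳ x ⟨
    x * 1#        ≈⟨ *-congˡ zy≈1 ⟨
    x * (z * y)   ≈⟨ solve 3 (λ x y z → x :* (z :* y) := z :* (x :* y)) refl x y z ⟩
    z * (x * y)   ≈⟨ *-congˡ xy≈0 ⟩
    z * 0#        ≈⟨ zeroʳ z ⟩
    0#            ∎
    where open ≈-Reasoning setoid

  y≈0⇒x*y≈0 : ∀ {y} x → y ≈ 0# → x * y ≈ 0#
  y≈0⇒x*y≈0 x y≈0 = trans (*-congˡ y≈0) (zeroʳ x)

  x≈0⇒x*y≈0 : ∀ {x} y → x ≈ 0# → x * y ≈ 0#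
  x≈0⇒x*y≈0 y x≈0 = trans (*-congʳ x≈0) (zeroˡ y)

  sum-zero : ∀ {n} {t : Vector K n} → (∀ i → t i ≈ 0#) → sum t ≈ 0#
  sum-zero {n} t≈0 = trans (sum-cong-≋ t≈0) (sum-replicate-zero n)

  δ : ∀ {n} → Fin n → Vector K n
  δ zero    = 1# ∷ λ _ → 0#
  δ (suc i) = 0# ∷ δ i

  δ-sym : ∀ {n} (i j : Fin n) → δ i j ≈ δ j i
  δ-sym zero    zero    = refl
  δ-sym zero    (suc j) = refl
  δ-sym (suc i) zero    = refl
  δ-sym (suc i) (suc j) = δ-sym i j

  sum-δ : ∀ {n} (i : Fin n) (t : Vector K n) → sum (λ k → δ i k * t k) ≈ t i
  sum-δ zero    t = trans (+-cong (*-identityˡ _) (sum-zero (zeroˡ ∘ tail t))) (+-identityʳ _)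
  sum-δ (suc i) t = trans (+-cong (zeroˡ _) (sum-δ i (tail t))) (+-identityˡ _)

  -- Turns a relation among reduced rows into one among the original rows: the pivot entry `t`
  -- collects minus the sum of all `a i * r i`.
  sum-eliminate : ∀ {n} (a x r : Vector K n) t →
    sum (λ i → a i * (x i - r i * t)) ≈ - sum (λ i → a i * r i) * t + sum (λ i → a i * x i)
  sum-eliminate {zero}  a x r t = solve 1 (λ t → con 0ℤ := :- con 0ℤ :* t :+ con 0ℤ) refl t
  sum-eliminate {suc n} a x r t = trans (+-congˡ (sum-eliminate (tail a) (tail x) (tail r) t))
    (solve 6 (λ a x r t s s′ → a :* (x :- r :* t) :+ (:- s :* t :+ s′)
                            := :- (a :* r :+ s) :* t :+ (a :* x :+ s′)) refl
      (a zero) (x zero) (r zero) t _ _)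

  -- Gaussian elimination with the first vector as pivot row.
  opaque
    dependent : ∀ {n} (v : Fin (suc n) → Vector K n) →
      ∃ λ (a : Vector K (suc n)) → (∃[ i ] a i ≉ 0#) × (∀ j → sum (λ i → a i * v i j) ≈ 0#)
    dependent {zero}  v = (λ _ → 1#) , (zero , 1≉0) , λ ()
    dependent {suc n} v with Fin.all? (λ j → v zero j ≟ 0#)
    ... | yes v₀≈0 = δ zero , (zero , 1≉0) , λ j → trans (sum-δ zero (λ i → v i j)) (v₀≈0 j)
    ... | no  v₀≉0
      with p , v₀p≉0 ← Fin.¬∀⟶∃¬ _ _ (λ j → v zero j ≟ 0#) v₀≉0
      with y , yv₀p≈1 ← inverse v₀p≉0
      -- Clearing column `p` with the pivot row and then deleting that column leaves one vector and
      -- one coordinate fewer.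
      with a , (i , aᵢ≉0) , relation ←
        dependent (λ i j → v (suc i) (punchIn p j) - v (suc i) p * y * v zero (punchIn p j))
      = (- sum (λ i → a i * (v (suc i) p * y))) ∷ a , (suc i , aᵢ≉0)
      , λ j → trans (sym (sum-eliminate a (λ i → v (suc i) j) (λ i → v (suc i) p * y) (v zero j))) (vanishes j)
      where
      vanishes : ∀ j → sum (λ i → a i * (v (suc i) j - v (suc i) p * y * v zero j)) ≈ 0#
      vanishes j with p Fin.≟ j
      ... | no  p≢j = ≡.subst (λ j → sum (λ i → a i * (v (suc i) j - v (suc i) p * y * v zero j)) ≈ 0#)
                        (Fin.punchIn-punchOut p≢j) (relation _)
      -- The deleted column: every cleared entry is itself zero, as `y` inverts the pivot.
      ... | yes ≡.refl = sum-zero λ i → y≈0⇒x*y≈0 (a i) (begin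
        v (suc i) p - v (suc i) p * y * v zero p   ≈⟨ +-congˡ (-‿cong (*-assoc _ _ _)) ⟩
        v (suc i) p - v (suc i) p * (y * v zero p) ≈⟨ +-congˡ (-‿cong (*-congˡ yv₀p≈1)) ⟩
        v (suc i) p - v (suc i) p * 1#             ≈⟨ solve 1 (λ x → x :- x :* con (+ 1) := con 0ℤ) refl _ ⟩
        0#                                         ∎)
        where open ≈-Reasoning setoid

module SymplecticSpace {c ℓ₁ ℓ₂} {q : ℕ} (F : HeytingField c ℓ₁ ℓ₂) (order : HasOrder F q)
                       (f : LinearAlgebra.NonDegenerateSymplecticForm F) where

  open FiniteField F order
  open CommutativeRing R renaming (Carrier to K) hiding (zero)
  open SemiringSum semiring using (sum; sum-cong-≋; ∑-distrib-+; *-distribˡ-sum)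
  open IntegerSolver R using (solve; con; :-_; _:+_; _:*_; _:-_; _:=_)
  open LinearAlgebra F hiding (K; _≈_; _+_; _*_; 0#; setoid; +-monoid)
  open NonDegenerateSymplecticForm f
  open IsBilinear bilinear renaming (cong to form-cong)
  open W₃ F f
  open ≈-Reasoning setoid
  private module Vₛ = Setoid Vₛ

  ⟪_,_⟫ : V → V → K
  ⟪ u , v ⟫ = form u v

  -- Subspaces and spans

  module _ (S : Subspace) where

    ∈-resp-≈ᵛ : ∀ {u v} → u ≈ᵛ v → u ∈ ⟦ S ⟧ → v ∈ ⟦ S ⟧
    ∈-resp-≈ᵛ = respects (Subspace.vectors S)

    +*-closed : ∀ {u v} a → u ∈ ⟦ S ⟧ → v ∈ ⟦ S ⟧ → (u +ᵛ a *ᵛ v) ∈ ⟦ S ⟧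
    +*-closed a u∈S v∈S = Subspace.+-closed S u∈S (Subspace.*-closed S a v∈S)

    linearCombination-closed : ∀ {d} a {b : Vector V d} → (∀ i → b i ∈ ⟦ S ⟧) → linearCombination a b ∈ ⟦ S ⟧
    linearCombination-closed {zero}  a b∈S = Subspace.0-closed S
    linearCombination-closed {suc d} a b∈S =
      Subspace.+-closed S (Subspace.*-closed S (a zero) (b∈S zero)) (linearCombination-closed (tail a) (b∈S ∘ suc))

  opaque
    ≈ᵛ0? : ∀ v → Dec (v ≈ᵛ 0ᵛ)
    ≈ᵛ0? v = Fin.all? (λ j → v j ≟ 0#)

  a*v≈0⇒a≈0 : ∀ {a v} → ¬ v ≈ᵛ 0ᵛ → a *ᵛ v ≈ᵛ 0ᵛ → a ≈ 0#
  a*v≈0⇒a≈0 {v = v} v≉0 av≈0 with j , vⱼ≉0 ← Fin.¬∀⟶∃¬ _ _ (λ j → v j ≟ 0#) v≉0 = x*y≈0⇒x≈0 vⱼ≉0 (av≈0 j)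

  span : ∀ {d} → Vector V d → Subspace
  span {d} b = record
    { vectors  = record
      { member   = λ v → ∃ λ (a : Vector K d) → v ≈ᵛ linearCombination a b
      ; respects = λ u≈v (a , u≈ab) → a , Vₛ.trans (Vₛ.sym u≈v) u≈ab
      }
    ; 0-closed = (λ _ → 0#) , λ j → sym (sum-zero λ i → zeroˡ (b i j))
    ; +-closed = λ {u} {v} (a , u≈ab) (a′ , v≈a′b) → (λ i → a i + a′ i) , λ j → begin
        u j + v j                                                   ≈⟨ +-cong (u≈ab j) (v≈a′b j) ⟩
        linearCombination a b j + linearCombination a′ b j          ≈⟨ ∑-distrib-+ (λ i → a i * b i j) (λ i → a′ i * b i j) ⟨
        sum (λ i → a i * b i j + a′ i * b i j)                      ≈⟨ sum-cong-≋ (λ i → distribʳ (b i j) (a i) (a′ i)) ⟨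
        linearCombination (λ i → a i + a′ i) b j                    ∎
    ; *-closed = λ x {v} (a , v≈ab) → (λ i → x * a i) , λ j → begin
        x * v j                                ≈⟨ *-congˡ (v≈ab j) ⟩
        x * linearCombination a b j            ≈⟨ *-distribˡ-sum x (λ i → a i * b i j) ⟩
        sum (λ i → x * (a i * b i j))          ≈⟨ sum-cong-≋ (λ i → *-assoc x (a i) (b i j)) ⟨
        linearCombination (λ i → x * a i) b j  ∎
    }

  ∈-span : ∀ {d} (b : Vector V d) i → b i ∈ ⟦ span b ⟧
  ∈-span b i = δ i , λ j → sym (sum-δ i (λ k → b k j))

  span⊆ : ∀ {d} (b : Vector V d) (S : Subspace) → (∀ i → b i ∈ ⟦ S ⟧) → ⟦ span b ⟧ ⊆ ⟦ S ⟧
  span⊆ b S b∈S (a , v≈ab) = ∈-resp-≈ᵛ S (Vₛ.sym v≈ab) (linearCombination-closed S a b∈S)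

  span-basis : ∀ {d} (b : Vector V d) → (∀ a → linearCombination a b ≈ᵛ 0ᵛ → ∀ i → a i ≈ 0#) → Basis (span b) d
  span-basis b independent = record
    { basis = b ; inside = ∈-span b ; independent = independent ; spanning = id }

  standard-basis-spans : ∀ v → v ≈ᵛ linearCombination v δ
  standard-basis-spans v j = begin
    v j                        ≈⟨ sum-δ j v ⟨
    sum (λ i → δ j i * v i)    ≈⟨ sum-cong-≋ (λ i → trans (*-comm (δ j i) (v i)) (*-congˡ (δ-sym j i))) ⟩
    sum (λ i → v i * δ i j)    ∎

  -- The form and orthogonality

  form-+*ˡ : ∀ u a v w → ⟪ u +ᵛ a *ᵛ v , w ⟫ ≈ ⟪ u , w ⟫ + a * ⟪ v , w ⟫
  form-+*ˡ u a v w = trans (+ˡ u (a *ᵛ v) w) (+-congˡ (*ˡ a v w))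

  form-+*ʳ : ∀ u v a w → ⟪ u , v +ᵛ a *ᵛ w ⟫ ≈ ⟪ u , v ⟫ + a * ⟪ u , w ⟫
  form-+*ʳ u v a w = trans (+ʳ u v (a *ᵛ w)) (+-congˡ (*ʳ a u w))

  -- Expand `⟪ u +ᵛ v , u +ᵛ v ⟫`, which vanishes, and drop the two diagonal terms.
  skew : ∀ u v → ⟪ u , v ⟫ ≈ - ⟪ v , u ⟫
  skew u v = begin
    ⟪ u , v ⟫
      ≈⟨ solve 4 (λ a x y b → x := a :+ x :+ (y :+ b) :- a :- b :- y) refl ⟪ u , u ⟫ ⟪ u , v ⟫ ⟪ v , u ⟫ ⟪ v , v ⟫ ⟩
    ⟪ u , u ⟫ + ⟪ u , v ⟫ + (⟪ v , u ⟫ + ⟪ v , v ⟫) - ⟪ u , u ⟫ - ⟪ v , v ⟫ - ⟪ v , u ⟫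
      ≈⟨ +-congʳ (+-cong (+-cong expansion≈0 (-‿cong (alternating u))) (-‿cong (alternating v))) ⟩
    0# - 0# - 0# - ⟪ v , u ⟫
      ≈⟨ solve 1 (λ y → con 0ℤ :- con 0ℤ :- con 0ℤ :- y := :- y) refl ⟪ v , u ⟫ ⟩
    - ⟪ v , u ⟫ ∎
    where
    expansion≈0 : ⟪ u , u ⟫ + ⟪ u , v ⟫ + (⟪ v , u ⟫ + ⟪ v , v ⟫) ≈ 0#
    expansion≈0 = begin
      ⟪ u , u ⟫ + ⟪ u , v ⟫ + (⟪ v , u ⟫ + ⟪ v , v ⟫) ≈⟨ +-cong (+ʳ u u v) (+ʳ v u v) ⟨
      ⟪ u , u +ᵛ v ⟫ + ⟪ v , u +ᵛ v ⟫                 ≈⟨ +ˡ u v (u +ᵛ v) ⟨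
      ⟪ u +ᵛ v , u +ᵛ v ⟫                             ≈⟨ alternating (u +ᵛ v) ⟩
      0#                                              ∎

  ⟂-sym : ∀ {u v} → ⟪ u , v ⟫ ≈ 0# → ⟪ v , u ⟫ ≈ 0#
  ⟂-sym {u} {v} uv≈0 = trans (skew v u) (trans (-‿cong uv≈0) (solve 0 (:- con 0ℤ := con 0ℤ) refl))

  form-0ʳ : ∀ u → ⟪ u , 0ᵛ ⟫ ≈ 0#
  form-0ʳ u = trans (form-cong Vₛ.refl (λ j → sym (zeroˡ 0#))) (trans (*ʳ 0# u 0ᵛ) (zeroˡ _))

  form-linearCombinationʳ : ∀ {d} u a (b : Vector V d) → ⟪ u , linearCombination a b ⟫ ≈ sum (λ i → a i * ⟪ u , b i ⟫)
  form-linearCombinationʳ {zero}  u a b = form-0ʳ u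
  form-linearCombinationʳ {suc d} u a b = trans (+ʳ u (a zero *ᵛ b zero) (linearCombination (tail a) (tail b)))
    (+-cong (*ʳ (a zero) u (b zero)) (form-linearCombinationʳ u (tail a) (tail b)))

  ⟂-linearCombination : ∀ {d} u a {b : Vector V d} → (∀ i → ⟪ u , b i ⟫ ≈ 0#) → ⟪ u , linearCombination a b ⟫ ≈ 0#
  ⟂-linearCombination u a {b} u⟂b = trans (form-linearCombinationʳ u a b) (sum-zero λ i → y≈0⇒x*y≈0 (a i) (u⟂b i))

  ⟂-span : ∀ {d} {b : Vector V d} {u v} → (∀ i → ⟪ u , b i ⟫ ≈ 0#) → v ∈ ⟦ span b ⟧ → ⟪ u , v ⟫ ≈ 0#
  ⟂-span {u = u} u⟂b (a , v≈ab) = trans (form-cong Vₛ.refl v≈ab) (⟂-linearCombination u a u⟂b)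

  -- Orthogonality passes from the spanning vectors to the span one argument at a time, with `⟂-sym`
  -- exchanging the arguments in between.
  span-isotropic : ∀ {d} {b : Vector V d} → (∀ i j → ⟪ b i , b j ⟫ ≈ 0#) → TotallyIsotropicOn form ⟦ span b ⟧
  span-isotropic b⟂b u∈ v∈ = ⟂-span (λ j → ⟂-sym (⟂-span (λ i → ⟂-sym (b⟂b i j)) u∈)) v∈

  opaque
    -- A vector orthogonal to the four unit vectors is orthogonal to V, so a search among these four
    -- produces the witness.
    not-orthogonal-to-all : ∀ {u} → ¬ u ≈ᵛ 0ᵛ → ∃[ t ] ⟪ u , t ⟫ ≉ 0#
    not-orthogonal-to-all {u} u≉0
      with j , uⱼ≉0 ← Fin.¬∀⟶∃¬ _ _ (λ j → ⟪ u , δ j ⟫ ≟ 0#)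
             (λ u⟂δ → u≉0 (nonDegenerate _ λ {v} _ →
               trans (form-cong Vₛ.refl (standard-basis-spans v)) (⟂-linearCombination u v u⟂δ)))
      = δ j , uⱼ≉0

  -- Isometries and their action on the incidence graph

  record IsIsometry (h : V → V) : Set (c ⊔ ℓ₁) where
    field
      cong      : ∀ {u v} → u ≈ᵛ v → h u ≈ᵛ h v
      +-homo    : ∀ u v → h (u +ᵛ v) ≈ᵛ h u +ᵛ h v
      *-homo    : ∀ a v → h (a *ᵛ v) ≈ᵛ a *ᵛ h v
      preserves : ∀ u v → ⟪ h u , h v ⟫ ≈ ⟪ u , v ⟫

    0-homo : h 0ᵛ ≈ᵛ 0ᵛ
    0-homo = Vₛ.trans (cong (λ j → sym (zeroˡ 0#))) (Vₛ.trans (*-homo 0# 0ᵛ) (λ j → zeroˡ _))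

    linearCombination-homo : ∀ {d} a (b : Vector V d) → h (linearCombination a b) ≈ᵛ linearCombination a (h ∘ b)
    linearCombination-homo {zero}  a b = 0-homo
    linearCombination-homo {suc d} a b =
      Vₛ.trans (+-homo (a zero *ᵛ b zero) (linearCombination (tail a) (tail b)))
               (λ j → +-cong (*-homo (a zero) (b zero) j) (linearCombination-homo (tail a) (tail b) j))

  ∘-isIsometry : ∀ {g h} → IsIsometry g → IsIsometry h → IsIsometry (g ∘ h)
  ∘-isIsometry {g} {h} G H = record
    { cong      = G.cong ∘ H.cong
    ; +-homo    = λ u v → Vₛ.trans (G.cong (H.+-homo u v)) (G.+-homo (h u) (h v))
    ; *-homo    = λ a v → Vₛ.trans (G.cong (H.*-homo a v)) (G.*-homo a (h v))
    ; preserves = λ u v → trans (G.preserves (h u) (h v)) (H.preserves u v)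
    }
    where
    module G = IsIsometry G
    module H = IsIsometry H

  record Isometry : Set (c ⊔ ℓ₁) where
    field
      to from         : V → V
      to-isIsometry   : IsIsometry to
      from-isIsometry : IsIsometry from
      to∘from         : ∀ v → to (from v) ≈ᵛ v
      from∘to         : ∀ v → from (to v) ≈ᵛ v

    module To   = IsIsometry to-isIsometry
    module From = IsIsometry from-isIsometry

  -- For composites of two transvections: the one applied first moves a vector to a multiple of its
  -- target, and the second must leave that multiple alone.
  fixes-multiple : ∀ {h} → IsIsometry h → ∀ {u v} a → h v ≈ᵛ v → u ≈ᵛ a *ᵛ v → h u ≈ᵛ a *ᵛ v
  fixes-multiple h-isometry {u} {v} a hv≈v u≈av = Vₛ.trans (cong u≈av) (Vₛ.trans (*-homo a v) (λ j → *-congˡ (hv≈v j)))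
    where open IsIsometry h-isometry

  infixr 9 _∘ᴵ_
  infix  10 _⁻¹

  _⁻¹ : Isometry → Isometry
  g ⁻¹ = record
    { to = from ; from = to ; to-isIsometry = from-isIsometry ; from-isIsometry = to-isIsometry
    ; to∘from = from∘to ; from∘to = to∘from }
    where open Isometry g

  _∘ᴵ_ : Isometry → Isometry → Isometry
  g ∘ᴵ h = record
    { to              = G.to ∘ H.to
    ; from            = H.from ∘ G.from
    ; to-isIsometry   = ∘-isIsometry G.to-isIsometry H.to-isIsometry
    ; from-isIsometry = ∘-isIsometry H.from-isIsometry G.from-isIsometry
    ; to∘from         = λ v → Vₛ.trans (G.To.cong (H.to∘from (G.from v))) (G.to∘from v)
    ; from∘to         = λ v → Vₛ.trans (H.From.cong (G.from∘to (H.to v))) (H.from∘to v)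
    }
    where
    module G = Isometry g
    module H = Isometry h

  -- Encoded as the preimage under `from`, so that membership involves no existential and closure is
  -- inherited from `S`.
  image : Isometry → Subspace → Subspace
  image g S = record
    { vectors  = record { member = λ v → from v ∈ ⟦ S ⟧ ; respects = λ u≈v → ∈-resp-≈ᵛ S (From.cong u≈v) }
    ; 0-closed = ∈-resp-≈ᵛ S (Vₛ.sym From.0-homo) (Subspace.0-closed S)
    ; +-closed = λ {u} {v} u∈ v∈ → ∈-resp-≈ᵛ S (Vₛ.sym (From.+-homo u v)) (Subspace.+-closed S u∈ v∈)
    ; *-closed = λ a {v} v∈ → ∈-resp-≈ᵛ S (Vₛ.sym (From.*-homo a v)) (Subspace.*-closed S a v∈)
    }
    where open Isometry g

  image-basis : ∀ g {S d} → Basis S d → Basis (image g S) d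
  image-basis g {S} B = record
    { basis       = to ∘ basis
    ; inside      = λ i → ∈-resp-≈ᵛ S (Vₛ.sym (from∘to (basis i))) (inside i)
    ; independent = λ a ab≈0 → independent a
        (Vₛ.trans (Vₛ.sym (from∘to _)) (Vₛ.trans (From.cong (Vₛ.trans (To.linearCombination-homo a basis) ab≈0)) From.0-homo))
    ; spanning    = λ {v} v∈ → let a , v≈ab = spanning v∈ in
        a , Vₛ.trans (Vₛ.sym (to∘from v)) (Vₛ.trans (To.cong v≈ab) (To.linearCombination-homo a basis))
    }
    where
    open Isometry g
    open Basis B

  -- Reduces equality with an image to one inclusion for `g` and one for its inverse, in place of
  -- comparing dimensions.
  image-≐ : ∀ g S T → (∀ {v} → v ∈ ⟦ S ⟧ → Isometry.to g v ∈ ⟦ T ⟧) → (∀ {v} → v ∈ ⟦ T ⟧ → Isometry.from g v ∈ ⟦ S ⟧) →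
    (⟦ image g S ⟧ ⊆ ⟦ T ⟧) × (⟦ T ⟧ ⊆ ⟦ image g S ⟧)
  image-≐ g S T to-∈ from-∈ = (λ {v} v∈ → ∈-resp-≈ᵛ T (Isometry.to∘from g v) (to-∈ v∈)) , from-∈

  act : Isometry → Vertex → Vertex
  act g (inj₁ P) = inj₁ (record { subspace = image g P.subspace ; dimension = image-basis g P.dimension })
    where module P = Point P
  act g (inj₂ L) = inj₂ (record
    { subspace  = image g L.subspace
    ; dimension = image-basis g L.dimension
    ; isotropic = λ {u} {v} u∈ v∈ → trans (sym (Isometry.From.preserves g u v)) (L.isotropic u∈ v∈)
    })
    where module L = Line L

  act-cong : ∀ g {x y} → x ≈ⱽ y → act g x ≈ⱽ act g y
  act-cong g (inj₁ (P⊆Q , Q⊆P)) = inj₁ ((λ v∈ → P⊆Q v∈) , λ v∈ → Q⊆P v∈)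
  act-cong g (inj₂ (L⊆M , M⊆L)) = inj₂ ((λ v∈ → L⊆M v∈) , λ v∈ → M⊆L v∈)

  image-inverse : ∀ g S → (⟦ image g (image (g ⁻¹) S) ⟧ ⊆ ⟦ S ⟧) × (⟦ S ⟧ ⊆ ⟦ image g (image (g ⁻¹) S) ⟧)
  image-inverse g S = (λ {v} → ∈-resp-≈ᵛ S (to∘from v)) , (λ {v} → ∈-resp-≈ᵛ S (Vₛ.sym (to∘from v)))
    where open Isometry g

  act-inverse : ∀ g x → act g (act (g ⁻¹) x) ≈ⱽ x
  act-inverse g (inj₁ P) = inj₁ (image-inverse g (Point.subspace P))
  act-inverse g (inj₂ L) = inj₂ (image-inverse g (Line.subspace L))

  image-⊆⇔ : ∀ g S T → (⟦ S ⟧ ⊆ ⟦ T ⟧) ⇔ (⟦ image g S ⟧ ⊆ ⟦ image g T ⟧)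
  image-⊆⇔ g S T = mk⇔ (λ S⊆T {v} → S⊆T {from v})
    (λ gS⊆gT {v} v∈S → ∈-resp-≈ᵛ T (from∘to v) (gS⊆gT (∈-resp-≈ᵛ S (Vₛ.sym (from∘to v)) v∈S)))
    where open Isometry g

  automorphism : Isometry → Automorphism
  automorphism g = record
    { permutation = record
      { to        = act g
      ; from      = act (g ⁻¹)
      ; to-cong   = act-cong g
      ; from-cong = act-cong (g ⁻¹)
      ; inverse   = (λ {x} y≈ → Setoid.trans Vertexₛ (act-cong g y≈) (act-inverse g x))
                  , (λ {x} y≈ → Setoid.trans Vertexₛ (act-cong (g ⁻¹) y≈) (act-inverse (g ⁻¹) x))
      }
    ; adjacency = λ where
        (inj₁ P) (inj₁ Q) → mk⇔ (λ ()) (λ ())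
        (inj₁ P) (inj₂ L) → image-⊆⇔ g (Point.subspace P) (Line.subspace L)
        (inj₂ L) (inj₁ P) → image-⊆⇔ g (Point.subspace P) (Line.subspace L)
        (inj₂ L) (inj₂ M) → mk⇔ (λ ()) (λ ())
    }

  -- Transvections

  transvection : K → V → V → V
  transvection a z x = x +ᵛ (a * ⟪ x , z ⟫) *ᵛ z

  -- In the expansion of the form, the two cross terms cancel by skew-symmetry and the quadratic
  -- term has the factor `⟪ z , z ⟫`.
  transvection-isIsometry : ∀ a z → IsIsometry (transvection a z)
  transvection-isIsometry a z = record
    { cong      = λ u≈v j → +-cong (u≈v j) (*-congʳ (*-congˡ (form-cong u≈v Vₛ.refl)))
    ; +-homo    = λ u v j → trans (+-congˡ (*-congʳ (*-congˡ (+ˡ u v z))))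
        (solve 6 (λ u v a z φ ψ → u :+ v :+ (a :* (φ :+ ψ)) :* z := (u :+ (a :* φ) :* z) :+ (v :+ (a :* ψ) :* z)) refl
          (u j) (v j) a (z j) ⟪ u , z ⟫ ⟪ v , z ⟫)
    ; *-homo    = λ b v j → trans (+-congˡ (*-congʳ (*-congˡ (*ˡ b v z))))
        (solve 5 (λ b v a z φ → b :* v :+ (a :* (b :* φ)) :* z := b :* (v :+ (a :* φ) :* z)) refl
          b (v j) a (z j) ⟪ v , z ⟫)
    ; preserves = λ u v → begin
        ⟪ transvection a z u , transvection a z v ⟫
          ≈⟨ form-+*ˡ u (a * ⟪ u , z ⟫) z (transvection a z v) ⟩
        ⟪ u , transvection a z v ⟫ + a * ⟪ u , z ⟫ * ⟪ z , transvection a z v ⟫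
          ≈⟨ +-cong (form-+*ʳ u v (a * ⟪ v , z ⟫) z) (*-congˡ (form-+*ʳ z v (a * ⟪ v , z ⟫) z)) ⟩
        ⟪ u , v ⟫ + a * ⟪ v , z ⟫ * ⟪ u , z ⟫ + a * ⟪ u , z ⟫ * (⟪ z , v ⟫ + a * ⟪ v , z ⟫ * ⟪ z , z ⟫)
          ≈⟨ +-congˡ (*-congˡ (+-cong (skew z v) (*-congˡ (alternating z)))) ⟩
        ⟪ u , v ⟫ + a * ⟪ v , z ⟫ * ⟪ u , z ⟫ + a * ⟪ u , z ⟫ * (- ⟪ v , z ⟫ + a * ⟪ v , z ⟫ * 0#)
          ≈⟨ solve 4 (λ a x u v → x :+ a :* v :* u :+ a :* u :* (:- v :+ a :* v :* con 0ℤ) := x) refl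
               a ⟪ u , v ⟫ ⟪ u , z ⟫ ⟪ v , z ⟫ ⟩
        ⟪ u , v ⟫ ∎
    }

  -- Since `z` is orthogonal to itself, a transvection with centre `z` does not change the pairing
  -- with `z`; hence the factors of two such maps add.
  transvection-inverse : ∀ {a b} z → a + b ≈ 0# → ∀ x → transvection a z (transvection b z x) ≈ᵛ x
  transvection-inverse {a} {b} z a+b≈0 x j = begin
    x j + b * φ * z j + a * ⟪ transvection b z x , z ⟫ * z j
      ≈⟨ +-congˡ (*-congʳ (*-congˡ (trans (form-+*ˡ x (b * φ) z z) (+-congˡ (*-congˡ (alternating z)))))) ⟩
    x j + b * φ * z j + a * (φ + b * φ * 0#) * z j
      ≈⟨ solve 5 (λ a b x φ z → x :+ b :* φ :* z :+ a :* (φ :+ b :* φ :* con 0ℤ) :* z := x :+ (a :+ b) :* (φ :* z)) refl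
           a b (x j) φ (z j) ⟩
    x j + (a + b) * (φ * z j)
      ≈⟨ +-congˡ (x≈0⇒x*y≈0 _ a+b≈0) ⟩
    x j + 0#
      ≈⟨ +-identityʳ _ ⟩
    x j ∎
    where φ = ⟪ x , z ⟫

  transvection-isometry : K → V → Isometry
  transvection-isometry a z = record
    { to              = transvection a z
    ; from            = transvection (- a) z
    ; to-isIsometry   = transvection-isIsometry a z
    ; from-isIsometry = transvection-isIsometry (- a) z
    ; to∘from         = transvection-inverse z (-‿inverseʳ a)
    ; from∘to         = transvection-inverse z (-‿inverseˡ a)
    }

  transvection-fixes : ∀ a {x z} → ⟪ x , z ⟫ ≈ 0# → transvection a z x ≈ᵛ x
  transvection-fixes a xz≈0 j =
    trans (+-congˡ (x≈0⇒x*y≈0 _ (y≈0⇒x*y≈0 a xz≈0))) (+-identityʳ _)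

  -- Captures a hyperbolic plane without reference to a basis, so that one argument serves both W
  -- and its perp.
  OrthogonalsProportional : Subspace → Set (c ⊔ ℓ₁)
  OrthogonalsProportional X =
    ∀ {u v} → u ∈ ⟦ X ⟧ → v ∈ ⟦ X ⟧ → ¬ u ≈ᵛ 0ᵛ → ⟪ u , v ⟫ ≈ 0# → ∃[ a ] v ≈ᵛ a *ᵛ u

  -- If p and q are not orthogonal, the transvection with centre q - p and
  -- factor 1/⟪ p , q ⟫ moves p to q.
  opaque
    move : ∀ X → OrthogonalsProportional X → ∀ {p q} → p ∈ ⟦ X ⟧ → q ∈ ⟦ X ⟧ → ¬ p ≈ᵛ 0ᵛ → ¬ q ≈ᵛ 0ᵛ →
      ∃₂ λ a z → z ∈ ⟦ X ⟧ × (∃[ b ] transvection a z p ≈ᵛ b *ᵛ q) × (∃[ b ] transvection (- a) z q ≈ᵛ b *ᵛ p)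
    move X proportional {p} {q} p∈X q∈X p≉0 q≉0 with ⟪ p , q ⟫ ≟ 0#
    ... | yes pq≈0
      with a , q≈ap ← proportional p∈X q∈X p≉0 pq≈0
      with b , p≈bq ← proportional q∈X p∈X q≉0 (⟂-sym pq≈0)
      -- Here `p` and `q` span the same point. The centre `p` is orthogonal to both, so both are
      -- fixed whatever the factor; 0 is a default.
      = 0# , p , p∈X
      , (b , Vₛ.trans (transvection-fixes 0# (alternating p)) p≈bq)
      , (a , Vₛ.trans (transvection-fixes (- 0#) (⟂-sym pq≈0)) q≈ap)
    ... | no pq≉0 with a , a[pq]≈1 ← inverse pq≉0
      = a , z , +*-closed X (- 1#) q∈X p∈X
      , (1# , λ j → trans (Tp≈q j) (sym (*-identityˡ _)))
      , (1# , λ j → trans (T⁻¹q≈p j) (sym (*-identityˡ _)))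
      where
      z : V
      z = q +ᵛ (- 1#) *ᵛ p
      Tp≈q : transvection a z p ≈ᵛ q
      Tp≈q j = begin
        p j + a * ⟪ p , z ⟫ * z j                    ≈⟨ +-congˡ (*-congʳ (*-congˡ (form-+*ʳ p q (- 1#) p))) ⟩
        p j + a * (⟪ p , q ⟫ + - 1# * ⟪ p , p ⟫) * z j ≈⟨ +-congˡ (*-congʳ (*-congˡ (+-congˡ (*-congˡ (alternating p))))) ⟩
        p j + a * (⟪ p , q ⟫ + - 1# * 0#) * z j      ≈⟨ +-congˡ (*-congʳ (*-congˡ (solve 1 (λ x → x :+ :- con (+ 1) :* con 0ℤ := x) refl ⟪ p , q ⟫))) ⟩
        p j + a * ⟪ p , q ⟫ * z j                    ≈⟨ +-congˡ (*-congʳ a[pq]≈1) ⟩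
        p j + 1# * z j                               ≈⟨ solve 2 (λ p q → p :+ con (+ 1) :* (q :+ :- con (+ 1) :* p) := q) refl (p j) (q j) ⟩
        q j                                          ∎
      T⁻¹q≈p : transvection (- a) z q ≈ᵛ p
      T⁻¹q≈p = Vₛ.trans (Vₛ.sym (IsIsometry.cong (transvection-isIsometry (- a) z) Tp≈q))
                        (transvection-inverse z (-‿inverseˡ a) p)

  -- Five vectors of V are dependent; pairing a relation among e₁, e₂, u, t, v,
  -- where ⟪ u , t ⟫ ≉ 0#, with u, e₁ and e₂ leaves a relation between u and v.
  opaque
    orthogonal-to-hyperbolic-pair : ∀ {e₁ e₂ u v} → ⟪ e₁ , e₂ ⟫ ≉ 0# →
      ⟪ e₁ , u ⟫ ≈ 0# → ⟪ e₂ , u ⟫ ≈ 0# → ⟪ e₁ , v ⟫ ≈ 0# → ⟪ e₂ , v ⟫ ≈ 0# →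
      ¬ u ≈ᵛ 0ᵛ → ⟪ u , v ⟫ ≈ 0# → ∃[ a ] v ≈ᵛ a *ᵛ u
    orthogonal-to-hyperbolic-pair {e₁} {e₂} {u} {v} e₁e₂≉0 e₁u≈0 e₂u≈0 e₁v≈0 e₂v≈0 u≉0 uv≈0
      with t , ut≉0 ← not-orthogonal-to-all u≉0
      with a , (i , aᵢ≉0) , relation ← dependent (e₁ ∷ e₂ ∷ u ∷ t ∷ v ∷ [])
      = solve-for-v
      where
      pairing : ∀ x → a 0F * ⟪ x , e₁ ⟫ + (a 1F * ⟪ x , e₂ ⟫ + (a 2F * ⟪ x , u ⟫ + (a 3F * ⟪ x , t ⟫ + (a 4F * ⟪ x , v ⟫ + 0#)))) ≈ 0#
      pairing x = trans (sym (form-linearCombinationʳ x a (e₁ ∷ e₂ ∷ u ∷ t ∷ v ∷ [])))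
        (trans (form-cong Vₛ.refl relation) (form-0ʳ x))

      -- This coefficient goes first: nothing is known about the pairings of `t` with `e₁` and `e₂`,
      -- which would otherwise remain in the next two relations.
      a₃≈0 : a 3F ≈ 0#
      a₃≈0 = x*y≈0⇒x≈0 ut≉0 (begin
        a 3F * ⟪ u , t ⟫
          ≈⟨ solve 1 (λ x → x := con 0ℤ :+ (con 0ℤ :+ (con 0ℤ :+ (x :+ (con 0ℤ :+ con 0ℤ))))) refl _ ⟩
        0# + (0# + (0# + (a 3F * ⟪ u , t ⟫ + (0# + 0#))))
          ≈⟨ +-cong (y≈0⇒x*y≈0 _ (⟂-sym e₁u≈0)) (+-cong (y≈0⇒x*y≈0 _ (⟂-sym e₂u≈0))
               (+-cong (y≈0⇒x*y≈0 _ (alternating u)) (+-congˡ (+-congʳ (y≈0⇒x*y≈0 _ uv≈0))))) ⟨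
        _ ≈⟨ pairing u ⟩
        0# ∎)

      a₁≈0 : a 1F ≈ 0#
      a₁≈0 = x*y≈0⇒x≈0 e₁e₂≉0 (begin
        a 1F * ⟪ e₁ , e₂ ⟫
          ≈⟨ solve 1 (λ x → x := con 0ℤ :+ (x :+ (con 0ℤ :+ (con 0ℤ :+ (con 0ℤ :+ con 0ℤ))))) refl _ ⟩
        0# + (a 1F * ⟪ e₁ , e₂ ⟫ + (0# + (0# + (0# + 0#))))
          ≈⟨ +-cong (y≈0⇒x*y≈0 _ (alternating e₁)) (+-congˡ (+-cong (y≈0⇒x*y≈0 _ e₁u≈0)
               (+-cong (x≈0⇒x*y≈0 _ a₃≈0) (+-congʳ (y≈0⇒x*y≈0 _ e₁v≈0))))) ⟨
        _ ≈⟨ pairing e₁ ⟩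
        0# ∎)

      a₀≈0 : a 0F ≈ 0#
      a₀≈0 = x*y≈0⇒x≈0 (e₁e₂≉0 ∘ ⟂-sym) (begin
        a 0F * ⟪ e₂ , e₁ ⟫
          ≈⟨ solve 1 (λ x → x := x :+ (con 0ℤ :+ (con 0ℤ :+ (con 0ℤ :+ (con 0ℤ :+ con 0ℤ))))) refl _ ⟩
        a 0F * ⟪ e₂ , e₁ ⟫ + (0# + (0# + (0# + (0# + 0#))))
          ≈⟨ +-congˡ (+-cong (y≈0⇒x*y≈0 _ (alternating e₂)) (+-cong (y≈0⇒x*y≈0 _ e₂u≈0)
               (+-cong (x≈0⇒x*y≈0 _ a₃≈0) (+-congʳ (y≈0⇒x*y≈0 _ e₂v≈0))))) ⟨
        _ ≈⟨ pairing e₂ ⟩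
        0# ∎)

      a₂u+a₄v≈0 : ∀ j → a 2F * u j + a 4F * v j ≈ 0#
      a₂u+a₄v≈0 j = begin
        a 2F * u j + a 4F * v j
          ≈⟨ solve 2 (λ x y → x :+ y := con 0ℤ :+ (con 0ℤ :+ (x :+ (con 0ℤ :+ (y :+ con 0ℤ))))) refl _ _ ⟩
        0# + (0# + (a 2F * u j + (0# + (a 4F * v j + 0#))))
          ≈⟨ +-cong (x≈0⇒x*y≈0 _ a₀≈0) (+-cong (x≈0⇒x*y≈0 _ a₁≈0) (+-congˡ (+-congʳ (x≈0⇒x*y≈0 _ a₃≈0)))) ⟨
        _ ≈⟨ relation j ⟩
        0# ∎

      -- If it vanished, only the term in the nonzero vector `u` would be left, and the whole
      -- relation would be trivial.
      a₄≉0 : a 4F ≉ 0#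
      a₄≉0 a₄≈0 = aᵢ≉0 (a≈0 i)
        where
        a₂≈0 : a 2F ≈ 0#
        a₂≈0 = a*v≈0⇒a≈0 u≉0 λ j →
          trans (sym (trans (+-congˡ (x≈0⇒x*y≈0 (v j) a₄≈0)) (+-identityʳ _))) (a₂u+a₄v≈0 j)
        a≈0 : ∀ i → a i ≈ 0#
        a≈0 0F = a₀≈0
        a≈0 1F = a₁≈0
        a≈0 2F = a₂≈0
        a≈0 3F = a₃≈0
        a≈0 4F = a₄≈0

      solve-for-v : ∃[ b ] v ≈ᵛ b *ᵛ u
      solve-for-v with y , ya₄≈1 ← inverse a₄≉0 = - (y * a 2F) , λ j → begin
        v j                                                     ≈⟨ *-identityˡ _ ⟨
        1# * v j                                                ≈⟨ *-congʳ ya₄≈1 ⟨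
        y * a 4F * v j                                          ≈⟨ solve 5 (λ y a b u v → y :* b :* v := y :* (a :* u :+ b :* v) :+ :- (y :* a) :* u) refl y (a 2F) (a 4F) (u j) (v j) ⟩
        y * (a 2F * u j + a 4F * v j) + - (y * a 2F) * u j      ≈⟨ +-congʳ (y≈0⇒x*y≈0 y (a₂u+a₄v≈0 j)) ⟩
        0# + - (y * a 2F) * u j                                 ≈⟨ +-identityˡ _ ⟩
        - (y * a 2F) * u j                                      ∎

  -- If it were zero, the coefficients `δ i` would give a nontrivial relation.
  basis-nonzero : ∀ {S d} (B : Basis S d) i → ¬ Basis.basis B i ≈ᵛ 0ᵛ
  basis-nonzero {d = d} B i bᵢ≈0 = 1≉0 (trans (sym (δ-diagonal i))
    (independent (δ i) (λ j → trans (sum-δ i (λ k → basis k j)) (bᵢ≈0 j)) i))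
    where
    open Basis B
    δ-diagonal : ∀ {n} (i : Fin n) → δ i i ≈ 1#
    δ-diagonal zero    = refl
    δ-diagonal (suc i) = δ-diagonal i

  -- Points and their generators

  module _ (P : Point) where

    open Point P
    open Basis dimension

    generator : V
    generator = basis zero

    generator-∈ : generator ∈ ⟦ subspace ⟧
    generator-∈ = inside zero

    generator-nonzero : ¬ generator ≈ᵛ 0ᵛ
    generator-nonzero = basis-nonzero dimension zero

    point-⊆ : ∀ S → generator ∈ ⟦ S ⟧ → ⟦ subspace ⟧ ⊆ ⟦ S ⟧
    point-⊆ S g∈S v∈ with a , v≈ag ← spanning v∈ =
      ∈-resp-≈ᵛ S (Vₛ.sym v≈ag) (linearCombination-closed S a {basis} λ { zero → g∈S })

  *-∈ : ∀ S {u v} a → u ≈ᵛ a *ᵛ v → v ∈ ⟦ S ⟧ → u ∈ ⟦ S ⟧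
  *-∈ S a u≈av v∈S = ∈-resp-≈ᵛ S (Vₛ.sym u≈av) (Subspace.*-closed S a v∈S)

  spanned-point : ∀ {w} → ¬ w ≈ᵛ 0ᵛ → Point
  spanned-point {w} w≉0 = record
    { subspace  = span (w ∷ [])
    ; dimension = span-basis (w ∷ []) λ where
        a aw≈0 zero → a*v≈0⇒a≈0 {a zero} {w} w≉0 (λ j → trans (sym (+-identityʳ (a zero * w j))) (aw≈0 j))
    }

  -- The decomposition of V into W and its perp

  module HyperbolicPlane (W : HyperbolicLine) where

    private module W = HyperbolicLine W
    open Basis W.dimension

    perp : Subspace
    perp = record
      { vectors  = record
        { member   = λ v → ∀ {w} → w ∈ ⟦ W.subspace ⟧ → ⟪ v , w ⟫ ≈ 0#
        ; respects = λ u≈v u⟂W w∈ → trans (form-cong (Vₛ.sym u≈v) Vₛ.refl) (u⟂W w∈)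
        }
      ; 0-closed = λ {w} _ → ⟂-sym (form-0ʳ w)
      ; +-closed = λ {u} {v} u⟂W v⟂W {w} w∈ → trans (+ˡ u v w) (trans (+-cong (u⟂W w∈) (v⟂W w∈)) (+-identityʳ 0#))
      ; *-closed = λ a {v} v⟂W {w} w∈ → trans (*ˡ a v w) (y≈0⇒x*y≈0 a (v⟂W w∈))
      }

    ⟂-basis⇒∈-perp : ∀ {v} → ⟪ v , basis 0F ⟫ ≈ 0# → ⟪ v , basis 1F ⟫ ≈ 0# → v ∈ ⟦ perp ⟧
    ⟂-basis⇒∈-perp vb₀≈0 vb₁≈0 w∈ = ⟂-span {b = basis} (λ { 0F → vb₀≈0 ; 1F → vb₁≈0 }) (spanning w∈)

    -- Otherwise the first basis vector would be orthogonal to both, hence to all of W, against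
    -- nondegeneracy.
    basis-not-orthogonal : ⟪ basis 0F , basis 1F ⟫ ≉ 0#
    basis-not-orthogonal b₀b₁≈0 =
      basis-nonzero W.dimension 0F (W.nonDegenerate (inside 0F) (⟂-basis⇒∈-perp (alternating _) b₀b₁≈0))

    opaque
      scale : K
      scale = proj₁ (inverse basis-not-orthogonal)

      scale-inverse : scale * ⟪ basis 0F , basis 1F ⟫ ≈ 1#
      scale-inverse = proj₂ (inverse basis-not-orthogonal)

    private
      d = ⟪ basis 0F , basis 1F ⟫

    -- Pairing with one basis vector reads off the other coordinate, up to sign and the factor `d`.
    form-basis₀ : ∀ a → ⟪ linearCombination a basis , basis 0F ⟫ ≈ - (a 1F * d)
    form-basis₀ a = begin
      ⟪ linearCombination a basis , basis 0F ⟫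
        ≈⟨ trans (skew _ _) (-‿cong (form-linearCombinationʳ (basis 0F) a basis)) ⟩
      - (a 0F * ⟪ basis 0F , basis 0F ⟫ + (a 1F * d + 0#))
        ≈⟨ -‿cong (+-congʳ (y≈0⇒x*y≈0 (a 0F) (alternating (basis 0F)))) ⟩
      - (0# + (a 1F * d + 0#))
        ≈⟨ solve 1 (λ x → :- (con 0ℤ :+ (x :+ con 0ℤ)) := :- x) refl (a 1F * d) ⟩
      - (a 1F * d) ∎

    form-basis₁ : ∀ a → ⟪ linearCombination a basis , basis 1F ⟫ ≈ a 0F * d
    form-basis₁ a = begin
      ⟪ linearCombination a basis , basis 1F ⟫
        ≈⟨ trans (skew _ _) (-‿cong (form-linearCombinationʳ (basis 1F) a basis)) ⟩
      - (a 0F * ⟪ basis 1F , basis 0F ⟫ + (a 1F * ⟪ basis 1F , basis 1F ⟫ + 0#))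
        ≈⟨ -‿cong (+-cong (*-congˡ (skew (basis 1F) (basis 0F))) (+-congʳ (y≈0⇒x*y≈0 (a 1F) (alternating (basis 1F))))) ⟩
      - (a 0F * - d + (0# + 0#))
        ≈⟨ solve 2 (λ a d → :- (a :* :- d :+ (con 0ℤ :+ con 0ℤ)) := a :* d) refl (a 0F) d ⟩
      a 0F * d ∎

    -- Found by solving `form-basis₀` and `form-basis₁` for the coordinates: the resulting vector of
    -- W pairs with both basis vectors as `v` does.
    π-coordinates : V → Vector K 2
    π-coordinates v = scale * ⟪ v , basis 1F ⟫ ∷ - (scale * ⟪ v , basis 0F ⟫) ∷ []

    -- The projection onto W along its perp.
    opaque
      π : V → V
      π v = linearCombination (π-coordinates v) basis

      π-∈ : ∀ v → π v ∈ ⟦ W.subspace ⟧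
      π-∈ v = linearCombination-closed W.subspace (π-coordinates v) {basis} inside

      form-π-basis₀ : ∀ v → ⟪ π v , basis 0F ⟫ ≈ scale * d * ⟪ v , basis 0F ⟫
      form-π-basis₀ v = trans (form-basis₀ (π-coordinates v))
        (solve 3 (λ s x d → :- (:- (s :* x) :* d) := s :* d :* x) refl scale ⟪ v , basis 0F ⟫ d)

      form-π-basis₁ : ∀ v → ⟪ π v , basis 1F ⟫ ≈ scale * d * ⟪ v , basis 1F ⟫
      form-π-basis₁ v = trans (form-basis₁ (π-coordinates v))
        (solve 3 (λ s x d → s :* x :* d := s :* d :* x) refl scale ⟪ v , basis 1F ⟫ d)

    π⊥ : V → V
    π⊥ v = v +ᵛ (- 1#) *ᵛ π v

    π+π⊥ : ∀ v → v ≈ᵛ π v +ᵛ π⊥ v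
    π+π⊥ v j = solve 2 (λ v p → v := p :+ (v :+ :- con (+ 1) :* p)) refl (v j) (π v j)

    π⊥-∈ : ∀ v → π⊥ v ∈ ⟦ perp ⟧
    π⊥-∈ v = ⟂-basis⇒∈-perp (⟂-π⊥ (form-π-basis₀ v)) (⟂-π⊥ (form-π-basis₁ v))
      where
      ⟂-π⊥ : ∀ {w} → ⟪ π v , w ⟫ ≈ scale * d * ⟪ v , w ⟫ → ⟪ π⊥ v , w ⟫ ≈ 0#
      ⟂-π⊥ {w} form-πv = begin
        ⟪ π⊥ v , w ⟫                               ≈⟨ form-+*ˡ v (- 1#) (π v) w ⟩
        ⟪ v , w ⟫ + - 1# * ⟪ π v , w ⟫             ≈⟨ +-congˡ (*-congˡ (trans form-πv (*-congʳ scale-inverse))) ⟩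
        ⟪ v , w ⟫ + - 1# * (1# * ⟪ v , w ⟫)        ≈⟨ solve 1 (λ x → x :+ :- con (+ 1) :* (con (+ 1) :* x) := con 0ℤ) refl _ ⟩
        0#                                         ∎

    π⊥≈0⇒≈π : ∀ {v} → π⊥ v ≈ᵛ 0ᵛ → v ≈ᵛ π v
    π⊥≈0⇒≈π {v} π⊥v≈0 j = trans (π+π⊥ v j) (trans (+-congˡ (π⊥v≈0 j)) (+-identityʳ (π v j)))

    -- For `v` in W the difference `π⊥ v` lies in both W and the perp, and nondegeneracy makes their
    -- intersection zero.
    ∈⇒π⊥≈0 : ∀ {v} → v ∈ ⟦ W.subspace ⟧ → π⊥ v ≈ᵛ 0ᵛ
    ∈⇒π⊥≈0 {v} v∈ = W.nonDegenerate (+*-closed W.subspace (- 1#) v∈ (π-∈ v)) (π⊥-∈ v)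

    form-π : ∀ v {w} → w ∈ ⟦ W.subspace ⟧ → ⟪ v , w ⟫ ≈ ⟪ π v , w ⟫
    form-π v {w} w∈ = begin
      ⟪ v , w ⟫                       ≈⟨ form-cong (π+π⊥ v) Vₛ.refl ⟩
      ⟪ π v +ᵛ π⊥ v , w ⟫             ≈⟨ +ˡ (π v) (π⊥ v) w ⟩
      ⟪ π v , w ⟫ + ⟪ π⊥ v , w ⟫      ≈⟨ +-congˡ (π⊥-∈ v w∈) ⟩
      ⟪ π v , w ⟫ + 0#                ≈⟨ +-identityʳ _ ⟩
      ⟪ π v , w ⟫                     ∎

    opaque
      perp-proportional : OrthogonalsProportional perp
      perp-proportional u∈ v∈ = orthogonal-to-hyperbolic-pair basis-not-orthogonal
        (⟂-sym (u∈ (inside 0F))) (⟂-sym (u∈ (inside 1F))) (⟂-sym (v∈ (inside 0F))) (⟂-sym (v∈ (inside 1F)))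

    -- In coordinates, ⟪ u , v ⟫ is the determinant of u and v times d.
    opaque
      hyperbolic-proportional : OrthogonalsProportional W.subspace
      hyperbolic-proportional {u} {v} u∈ v∈ u≉0 uv≈0
        with a , u≈ab ← spanning u∈ | b , v≈bb ← spanning v∈
        = proportional (Fin.¬∀⟶∃¬ _ _ (λ i → a i ≟ 0#) a≉0)
        where
        a≉0 : ¬ (∀ i → a i ≈ 0#)
        a≉0 a≈0 = u≉0 (λ j → trans (u≈ab j) (sum-zero (λ i → x≈0⇒x*y≈0 (basis i j) (a≈0 i))))

        a₀b₁≈a₁b₀ : a 0F * b 1F ≈ a 1F * b 0F
        a₀b₁≈a₁b₀ = begin
          a 0F * b 1F                               ≈⟨ solve 2 (λ x y → x := y :+ (x :- y)) refl _ _ ⟩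
          a 1F * b 0F + (a 0F * b 1F - a 1F * b 0F) ≈⟨ +-congˡ (x*y≈0⇒x≈0 basis-not-orthogonal determinant) ⟩
          a 1F * b 0F + 0#                          ≈⟨ +-identityʳ _ ⟩
          a 1F * b 0F                               ∎
          where
          determinant : (a 0F * b 1F - a 1F * b 0F) * d ≈ 0#
          determinant = begin
            (a 0F * b 1F - a 1F * b 0F) * d
              ≈⟨ solve 5 (λ a₀ a₁ b₀ b₁ d → (a₀ :* b₁ :- a₁ :* b₀) :* d
                                         := b₀ :* :- (a₁ :* d) :+ (b₁ :* (a₀ :* d) :+ con 0ℤ)) refl
                   (a 0F) (a 1F) (b 0F) (b 1F) d ⟩
            b 0F * - (a 1F * d) + (b 1F * (a 0F * d) + 0#)
              ≈⟨ +-cong (*-congˡ (form-basis₀ a)) (+-congʳ (*-congˡ (form-basis₁ a))) ⟨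
            sum (λ i → b i * ⟪ linearCombination a basis , basis i ⟫)
              ≈⟨ form-linearCombinationʳ (linearCombination a basis) b basis ⟨
            ⟪ linearCombination a basis , linearCombination b basis ⟫
              ≈⟨ form-cong u≈ab v≈bb ⟨
            ⟪ u , v ⟫
              ≈⟨ uv≈0 ⟩
            0# ∎

        -- Stated for all pairs of indices, so that it applies whichever coordinate of `u` turns out
        -- to be nonzero.
        minor : ∀ i j → a i * b j ≈ a j * b i
        minor 0F 0F = refl
        minor 0F 1F = a₀b₁≈a₁b₀
        minor 1F 0F = sym a₀b₁≈a₁b₀
        minor 1F 1F = refl

        proportional : (∃[ i ] a i ≉ 0#) → ∃[ c ] v ≈ᵛ c *ᵛ u
        -- The factor is the quotient of `b i` by `a i`; the vanishing minors show that it is right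
        -- in the other coordinate too.
        proportional (i , aᵢ≉0) with y , yaᵢ≈1 ← inverse aᵢ≉0 = y * b i , λ k → begin
          v k                                         ≈⟨ v≈bb k ⟩
          linearCombination b basis k                 ≈⟨ sum-cong-≋ (λ j → *-congʳ {basis j k} (b≈ j)) ⟩
          sum (λ j → y * b i * a j * basis j k)       ≈⟨ sum-cong-≋ (λ j → *-assoc (y * b i) (a j) (basis j k)) ⟩
          sum (λ j → y * b i * (a j * basis j k))     ≈⟨ *-distribˡ-sum (y * b i) (λ j → a j * basis j k) ⟨
          y * b i * linearCombination a basis k       ≈⟨ *-congˡ (u≈ab k) ⟨
          y * b i * u k                               ∎
          where
          b≈ : ∀ j → b j ≈ y * b i * a j
          b≈ j = begin
            b j               ≈⟨ *-identityˡ _ ⟨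
            1# * b j          ≈⟨ *-congʳ yaᵢ≈1 ⟨
            y * a i * b j     ≈⟨ *-assoc _ _ _ ⟩
            y * (a i * b j)   ≈⟨ *-congˡ (minor i j) ⟩
            y * (a j * b i)   ≈⟨ solve 3 (λ y a b → y :* (a :* b) := y :* b :* a) refl y (a j) (b i) ⟩
            y * b i * a j     ∎

    -- The points of W as a maximal partial ovoid

    C : Code (c ⊔ ℓ₁)
    C = pointCode (pointsOf W)

    orthogonal-generators⇒⊆ : ∀ P Q → P ∈ member (pointsOf W) → Q ∈ member (pointsOf W) →
      ⟪ generator P , generator Q ⟫ ≈ 0# → ⟦ Point.subspace Q ⟧ ⊆ ⟦ Point.subspace P ⟧
    orthogonal-generators⇒⊆ P Q P⊆W Q⊆W pq≈0
      with a , q≈ap ← hyperbolic-proportional (P⊆W (generator-∈ P)) (Q⊆W (generator-∈ Q)) (generator-nonzero P) pq≈0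
      = point-⊆ Q (Point.subspace P) (*-∈ (Point.subspace P) a q≈ap (generator-∈ P))

    isPartialOvoid : IsPartialOvoid (pointsOf W)
    isPartialOvoid L {P} {Q} P⊆W Q⊆W P⊆L Q⊆L =
      orthogonal-generators⇒⊆ Q P Q⊆W P⊆W (Line.isotropic L (Q⊆L (generator-∈ Q)) (P⊆L (generator-∈ P))) ,
      orthogonal-generators⇒⊆ P Q P⊆W Q⊆W (Line.isotropic L (P⊆L (generator-∈ P)) (Q⊆L (generator-∈ Q)))

    orthogonal-in-plane : ∀ v → ∃[ w ] w ∈ ⟦ W.subspace ⟧ × (¬ w ≈ᵛ 0ᵛ) × ⟪ v , w ⟫ ≈ 0#
    orthogonal-in-plane v with ≈ᵛ0? (π v)
    ... | no  πv≉0 = π v , π-∈ v , πv≉0 , trans (form-π v (π-∈ v)) (alternating (π v))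
    ... | yes πv≈0 = basis 0F , inside 0F , basis-nonzero W.dimension 0F ,
      trans (form-π v (inside 0F)) (trans (form-cong πv≈0 Vₛ.refl) (⟂-sym (form-0ʳ (basis 0F))))

    -- If `a` were invertible, `v` would be a multiple of `w` and so lie in W, where the component
    -- `π⊥ v` vanishes.
    first-coefficient≈0 : ∀ {v w} → ¬ π⊥ v ≈ᵛ 0ᵛ → w ∈ ⟦ W.subspace ⟧ →
      ∀ a b → a *ᵛ v +ᵛ b *ᵛ w ≈ᵛ 0ᵛ → a ≈ 0#
    first-coefficient≈0 {v} {w} π⊥v≉0 w∈W a b relation with a ≟ 0#
    ... | yes a≈0 = a≈0
    ... | no  a≉0 with y , ya≈1 ← inverse a≉0 =
      contradiction (∈⇒π⊥≈0 (*-∈ W.subspace (- (y * b)) v≈ w∈W)) π⊥v≉0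
      where
      v≈ : v ≈ᵛ (- (y * b)) *ᵛ w
      v≈ j = begin
        v j                                       ≈⟨ *-identityˡ _ ⟨
        1# * v j                                  ≈⟨ *-congʳ ya≈1 ⟨
        y * a * v j                               ≈⟨ solve 5 (λ y a b v w → y :* a :* v := y :* (a :* v :+ b :* w) :+ :- (y :* b) :* w) refl
                                                       y a b (v j) (w j) ⟩
        y * (a * v j + b * w j) + - (y * b) * w j ≈⟨ +-congʳ (y≈0⇒x*y≈0 y (relation j)) ⟩
        0# + - (y * b) * w j                      ≈⟨ +-identityˡ _ ⟩
        - (y * b) * w j                           ∎

    independent-pair : ∀ {v w} → ¬ π⊥ v ≈ᵛ 0ᵛ → w ∈ ⟦ W.subspace ⟧ → ¬ w ≈ᵛ 0ᵛ →
      ∀ a → linearCombination a (v ∷ w ∷ []) ≈ᵛ 0ᵛ → ∀ i → a i ≈ 0#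
    independent-pair {v} {w} π⊥v≉0 w∈W w≉0 a relation = λ where
        0F → a₀≈0
        1F → a*v≈0⇒a≈0 w≉0 λ j → begin
          a 1F * w j                ≈⟨ +-identityˡ _ ⟨
          0# + a 1F * w j           ≈⟨ +-congʳ (x≈0⇒x*y≈0 (v j) a₀≈0) ⟨
          a 0F * v j + a 1F * w j   ≈⟨ av+bw≈0 j ⟩
          0#                        ∎
      where
      av+bw≈0 : a 0F *ᵛ v +ᵛ a 1F *ᵛ w ≈ᵛ 0ᵛ
      av+bw≈0 j = trans (+-congˡ (sym (+-identityʳ _))) (relation j)
      a₀≈0 : a 0F ≈ 0#
      a₀≈0 = first-coefficient≈0 π⊥v≉0 w∈W (a 0F) (a 1F) av+bw≈0

    spanned-line : ∀ {v w} → ¬ π⊥ v ≈ᵛ 0ᵛ → w ∈ ⟦ W.subspace ⟧ → ¬ w ≈ᵛ 0ᵛ → ⟪ v , w ⟫ ≈ 0# → Line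
    spanned-line {v} {w} π⊥v≉0 w∈W w≉0 vw≈0 = record
      { subspace  = span (v ∷ w ∷ [])
      ; dimension = span-basis (v ∷ w ∷ []) (independent-pair π⊥v≉0 w∈W w≉0)
      ; isotropic = span-isotropic {b = v ∷ w ∷ []} λ where
          0F 0F → alternating v
          0F 1F → vw≈0
          1F 0F → ⟂-sym vw≈0
          1F 1F → alternating w
      }

    isMaximal : ∀ S → IsPartialOvoid S → ¬ (member (pointsOf W) ⊂ member S)
    isMaximal S ovoid (W⊆S , S⊈W) = S⊈W S⊆W
      where
      S⊆W : member S ⊆ member (pointsOf W)
      S⊆W {P} P∈S with ≈ᵛ0? (π⊥ (generator P))
      ... | yes π⊥p≈0 = point-⊆ P W.subspace (∈-resp-≈ᵛ W.subspace (Vₛ.sym (π⊥≈0⇒≈π π⊥p≈0)) (π-∈ _))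
      -- The points `P` and ⟨w⟩ both belong to `S` and lie on the line `L`, so they coincide, which
      -- places `P` in W after all.
      ... | no  π⊥p≉0 with w , w∈W , w≉0 , pw≈0 ← orthogonal-in-plane (generator P) =
        λ v∈P → ⟨w⟩⊆W (proj₁ P≈⟨w⟩ v∈P)
        where
        ⟨w⟩⊆W : ⟦ span (w ∷ []) ⟧ ⊆ ⟦ W.subspace ⟧
        ⟨w⟩⊆W = span⊆ (w ∷ []) W.subspace λ { zero → w∈W }
        L : Line
        L = spanned-line π⊥p≉0 w∈W w≉0 pw≈0
        P≈⟨w⟩ : P ≈ᴾ spanned-point w≉0
        P≈⟨w⟩ = ovoid L {P} {spanned-point w≉0} P∈S (W⊆S {spanned-point w≉0} ⟨w⟩⊆W)
          (point-⊆ P (Line.subspace L) (∈-span (generator P ∷ w ∷ []) 0F))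
          (span⊆ (w ∷ []) (Line.subspace L) λ { zero → ∈-span (generator P ∷ w ∷ []) 1F })

    -- The stabiliser of W and its transitivity

    Fixes : Isometry → Set (c ⊔ ℓ₁)
    Fixes g = (∀ {v} → v ∈ ⟦ W.subspace ⟧ → Isometry.to g v ∈ ⟦ W.subspace ⟧) ×
              (∀ {v} → v ∈ ⟦ W.subspace ⟧ → Isometry.from g v ∈ ⟦ W.subspace ⟧)

    -- Invariance of W under `to` gives one direction and under `from` the other; lines never belong
    -- to `C`.
    stabilises : ∀ g → Fixes g → Stabilises (automorphism g) C
    stabilises g (to-∈ , from-∈) (inj₁ P) = mk⇔
      (λ P⊆W {v} v∈ → ∈-resp-≈ᵛ W.subspace (Isometry.to∘from g v) (to-∈ (P⊆W v∈)))
      (λ gP⊆W {v} v∈P → ∈-resp-≈ᵛ W.subspace (Isometry.from∘to g v)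
        (from-∈ (gP⊆W (∈-resp-≈ᵛ (Point.subspace P) (Vₛ.sym (Isometry.from∘to g v)) v∈P))))
    stabilises g _ (inj₂ L) = mk⇔ (λ ()) (λ ())

    transvection-∈ : ∀ {z} → z ∈ ⟦ W.subspace ⟧ → ∀ a {v} → v ∈ ⟦ W.subspace ⟧ → transvection a z v ∈ ⟦ W.subspace ⟧
    transvection-∈ z∈W a v∈W = +*-closed W.subspace _ v∈W z∈W

    fixed-by-perp : ∀ {z v} → z ∈ ⟦ perp ⟧ → ∀ a → v ∈ ⟦ W.subspace ⟧ → transvection a z v ≈ᵛ v
    fixed-by-perp z⟂W a v∈W = transvection-fixes a (⟂-sym (z⟂W v∈W))

    perp-transvection-∈ : ∀ {z} → z ∈ ⟦ perp ⟧ → ∀ a {v} → v ∈ ⟦ W.subspace ⟧ → transvection a z v ∈ ⟦ W.subspace ⟧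
    perp-transvection-∈ z⟂W a v∈W = ∈-resp-≈ᵛ W.subspace (Vₛ.sym (fixed-by-perp z⟂W a v∈W)) v∈W

    transitive-on-points : StabiliserTransitiveOn C (member C)
    transitive-on-points {inj₁ P} {inj₁ Q} P⊆W Q⊆W
      with a , z , z∈W , (b , Tp≈bq) , (b′ , T⁻¹q≈b′p) ←
        move W.subspace hyperbolic-proportional (P⊆W (generator-∈ P)) (Q⊆W (generator-∈ Q))
          (generator-nonzero P) (generator-nonzero Q)
      = automorphism g
      , stabilises g (transvection-∈ z∈W a , transvection-∈ z∈W (- a))
      -- The generators are matched only up to the scalars `b` and `b′`, which subspaces do not see.
      , inj₁ (image-≐ g (Point.subspace P) (Point.subspace Q)
          (point-⊆ P (image (g ⁻¹) (Point.subspace Q)) (*-∈ (Point.subspace Q) b Tp≈bq (generator-∈ Q)))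
          (point-⊆ Q (image g (Point.subspace P)) (*-∈ (Point.subspace P) b′ T⁻¹q≈b′p (generator-∈ P))))
      where g = transvection-isometry a z
    transitive-on-points {inj₁ _} {inj₂ _} _ ()
    transitive-on-points {inj₂ _} ()

    -- A line L meeting W in the point P is spanned by P and a vector orthogonal to W.
    record Splitting (P : Point) (L : Line) : Set (c ⊔ ℓ₁) where
      field
        normal         : V
        normal-∈       : normal ∈ ⟦ Line.subspace L ⟧
        normal-⟂       : normal ∈ ⟦ perp ⟧
        normal-nonzero : ¬ normal ≈ᵛ 0ᵛ
        splits         : ∀ {v} → v ∈ ⟦ Line.subspace L ⟧ → ∃₂ λ a b → v ≈ᵛ a *ᵛ generator P +ᵛ b *ᵛ normal

    -- On the isotropic line `L` through `P`, the W-component of any vector is orthogonal to the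
    -- generator `p` of `P`, hence a multiple of it and again in `L`. So the perp component is in
    -- `L` as well, and it cannot vanish for both basis vectors, which would then be multiples of
    -- `p`.
    splitting : ∀ P L → P ∈ member (pointsOf W) → Incident P L → Splitting P L
    splitting P L P⊆W P⊆L = record
      { normal         = u
      ; normal-∈       = π⊥-∈L (inside′ i)
      ; normal-⟂       = π⊥-∈ (basis′ i)
      ; normal-nonzero = u≉0
      ; splits         = splits
      }
      where
      module L = Line L
      open Basis L.dimension hiding (spanning) renaming (basis to basis′; inside to inside′; independent to independent′)
      p = generator P
      p∈W = P⊆W (generator-∈ P)
      p∈L = P⊆L (generator-∈ P)

      π-proportional : ∀ {v} → v ∈ ⟦ L.subspace ⟧ → ∃[ a ] π v ≈ᵛ a *ᵛ p
      π-proportional {v} v∈L = hyperbolic-proportional p∈W (π-∈ v) (generator-nonzero P)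
        (⟂-sym (trans (sym (form-π v p∈W)) (L.isotropic v∈L p∈L)))

      π⊥-∈L : ∀ {v} → v ∈ ⟦ L.subspace ⟧ → π⊥ v ∈ ⟦ L.subspace ⟧
      π⊥-∈L {v} v∈L = let a , πv≈ap = π-proportional v∈L in
        +*-closed L.subspace (- 1#) v∈L (*-∈ L.subspace {π v} {p} a πv≈ap p∈L)

      ¬π⊥≈0 : ¬ (∀ i → π⊥ (basis′ i) ≈ᵛ 0ᵛ)
      ¬π⊥≈0 π⊥≈0 = basis-nonzero L.dimension 1F λ j → trans (b₁≈bp j) (x≈0⇒x*y≈0 (p j) b≈0)
        where
        a b : K
        a = proj₁ (π-proportional (inside′ 0F))
        b = proj₁ (π-proportional (inside′ 1F))
        b₀≈ap : basis′ 0F ≈ᵛ a *ᵛ p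
        b₀≈ap = Vₛ.trans (π⊥≈0⇒≈π (π⊥≈0 0F)) (proj₂ (π-proportional (inside′ 0F)))
        b₁≈bp : basis′ 1F ≈ᵛ b *ᵛ p
        b₁≈bp = Vₛ.trans (π⊥≈0⇒≈π (π⊥≈0 1F)) (proj₂ (π-proportional (inside′ 1F)))
        b≈0 : b ≈ 0#
        -- The relation is `b * (a * p) - a * (b * p)`; independence then makes the second basis
        -- vector zero.
        b≈0 = independent′ (b ∷ - a ∷ []) (λ j → begin
          b * basis′ 0F j + (- a * basis′ 1F j + 0#)
            ≈⟨ +-cong (*-congˡ (b₀≈ap j)) (+-congʳ (*-congˡ (b₁≈bp j))) ⟩
          b * (a * p j) + (- a * (b * p j) + 0#)
            ≈⟨ solve 3 (λ a b p → b :* (a :* p) :+ (:- a :* (b :* p) :+ con 0ℤ) := con 0ℤ) refl a b (p j) ⟩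
          0# ∎) 0F

      off-W : ∃[ i ] ¬ π⊥ (basis′ i) ≈ᵛ 0ᵛ
      off-W = Fin.¬∀⟶∃¬ _ _ (λ i → ≈ᵛ0? (π⊥ (basis′ i))) ¬π⊥≈0

      i = proj₁ off-W
      u = π⊥ (basis′ i)
      u≉0 = proj₂ off-W

      splits : ∀ {v} → v ∈ ⟦ L.subspace ⟧ → ∃₂ λ a b → v ≈ᵛ a *ᵛ p +ᵛ b *ᵛ u
      splits {v} v∈L =
        let a , πv≈ap  = π-proportional v∈L
            -- Two perp components of vectors of `L` lie in `L`, so they are orthogonal and hence
            -- proportional.
            b , π⊥v≈bu = perp-proportional (π⊥-∈ (basis′ i)) (π⊥-∈ v) u≉0
                           (L.isotropic (π⊥-∈L (inside′ i)) (π⊥-∈L v∈L))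
        in a , b , λ j → trans (π+π⊥ v j) (+-cong (πv≈ap j) (π⊥v≈bu j))

    splitting-⊆ : ∀ {P L} (s : Splitting P L) S → generator P ∈ ⟦ S ⟧ → Splitting.normal s ∈ ⟦ S ⟧ →
      ⟦ Line.subspace L ⟧ ⊆ ⟦ S ⟧
    splitting-⊆ s S p∈S u∈S v∈L = let a , b , v≈ = Splitting.splits s v∈L in
      ∈-resp-≈ᵛ S (Vₛ.sym v≈) (+*-closed S b (Subspace.*-closed S a p∈S) u∈S)

    -- One transvection moves the W-part, the other the perp-part; each fixes the
    -- summand in which the other one acts.
    carry-line : ∀ {P Q L M} → P ∈ member (pointsOf W) → Q ∈ member (pointsOf W) → Incident P L → Incident Q M →
      Splitting P L → Splitting Q M → ∃[ g ] Stabilises g C × Automorphism.to g (inj₂ L) ≈ⱽ inj₂ M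
    carry-line {P} {Q} {L} {M} P⊆W Q⊆W P⊆L Q⊆M s t
      with a , z , z∈W , (b , Tp≈bq) , (b′ , T⁻¹q≈b′p) ←
        move W.subspace hyperbolic-proportional (P⊆W (generator-∈ P)) (Q⊆W (generator-∈ Q))
          (generator-nonzero P) (generator-nonzero Q)
      with a′ , z′ , z′⟂W , (c , T′u≈cw) , (c′ , T′⁻¹w≈c′u) ←
        move perp perp-proportional (Splitting.normal-⟂ s) (Splitting.normal-⟂ t)
          (Splitting.normal-nonzero s) (Splitting.normal-nonzero t)
      -- As `T` acts before `T′`, the generator of `P` is moved and its image then fixed, whereas
      -- the normal of `L` is fixed and then moved. The inverse, applied to the generator of `Q` and
      -- the normal of `M`, takes the two factors in the opposite order.
      = automorphism g , stabilises g (to-∈ , from-∈) , inj₂ (image-≐ g L.subspace M.subspace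
          (splitting-⊆ s (image (g ⁻¹) M.subspace)
            (*-∈ M.subspace b (fixes-multiple T′.to-isIsometry b (fixed-by-perp z′⟂W a′ q∈W) Tp≈bq) (Q⊆M (generator-∈ Q)))
            (*-∈ M.subspace c (Vₛ.trans (T′.To.cong (transvection-fixes a (s.normal-⟂ z∈W))) T′u≈cw) t.normal-∈))
          (splitting-⊆ t (image g L.subspace)
            (*-∈ L.subspace b′ (Vₛ.trans (T.From.cong (fixed-by-perp z′⟂W (- a′) q∈W)) T⁻¹q≈b′p) (P⊆L (generator-∈ P)))
            (*-∈ L.subspace c′ (fixes-multiple T.from-isIsometry c′ (transvection-fixes (- a) (s.normal-⟂ z∈W)) T′⁻¹w≈c′u) s.normal-∈)))
      where
      module L = Line L
      module M = Line M
      module s = Splitting s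
      module t = Splitting t
      module T = Isometry (transvection-isometry a z)
      module T′ = Isometry (transvection-isometry a′ z′)
      g : Isometry
      g = transvection-isometry a′ z′ ∘ᴵ transvection-isometry a z
      q∈W : generator Q ∈ ⟦ W.subspace ⟧
      q∈W = Q⊆W (generator-∈ Q)
      to-∈ : ∀ {v} → v ∈ ⟦ W.subspace ⟧ → Isometry.to g v ∈ ⟦ W.subspace ⟧
      to-∈ v∈W = perp-transvection-∈ z′⟂W a′ (transvection-∈ z∈W a v∈W)
      from-∈ : ∀ {v} → v ∈ ⟦ W.subspace ⟧ → Isometry.from g v ∈ ⟦ W.subspace ⟧
      from-∈ v∈W = transvection-∈ z∈W (- a) (perp-transvection-∈ z′⟂W (- a′) v∈W)

    -- The graph is bipartite and `C` consists of points, so every neighbour is a line, and its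
    -- adjacent element of `C` supplies the point for the splitting.
    transitive-on-neighbours : StabiliserTransitiveOn C (Neighbours C)
    transitive-on-neighbours {inj₂ L} {inj₂ M} (_ , inj₁ P , P⊆W , P⊆L) (_ , inj₁ Q , Q⊆W , Q⊆M) =
      carry-line {P} {Q} {L} {M} P⊆W Q⊆W P⊆L Q⊆M (splitting P L P⊆W P⊆L) (splitting Q M Q⊆W Q⊆M)
    transitive-on-neighbours {inj₁ _}          (_ , inj₁ _ , _ , ())
    transitive-on-neighbours {inj₁ _}          (_ , inj₂ _ , () , _)
    transitive-on-neighbours {inj₂ _} {_}      (_ , inj₂ _ , () , _)
    transitive-on-neighbours {inj₂ _} {inj₁ _} _ (_ , inj₁ _ , _ , ())
    transitive-on-neighbours {inj₂ _} {inj₁ _} _ (_ , inj₂ _ , () , _)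
    transitive-on-neighbours {inj₂ _} {inj₂ _} _ (_ , inj₂ _ , () , _)

proposition5p2 : ∀ {c ℓ₁ ℓ₂} (q : ℕ) → IsPrimePower q →
    (F : HeytingField c ℓ₁ ℓ₂) → HasOrder F q →
    (f : LinearAlgebra.NonDegenerateSymplecticForm F) →
    (W : W₃.HyperbolicLine F f) →
    let open W₃ F f in
    IsNeighbourTransitive (pointCode (pointsOf W)) ×
    IsMaximalPartialOvoid (pointsOf W)
proposition5p2 q _ F order f W =
  (transitive-on-points , transitive-on-neighbours) , isPartialOvoid , isMaximal
  where open SymplecticSpace.HyperbolicPlane F order f W
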